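{- Every DP-good graph belongs to $DP^*$.
   Context: All graphs are finite and simple. For a graph $G$ and $m\in\mathbb{N}$, a cover of $G$ is a pair $\mathcal{H}=(L,H)$ where $H$ is a graph and $L$ maps each vertex of $G$ to a subset of $V(H)$ such that: $\{L(u):u\in V(G)\}$ is a partition of $V(H)$; each $H[L(u)]$ is complete; if $u,v$ are non-adjacent in $G$ there are no edges of $H$ between $L(u)$ and $L(v)$; and for each edge $uv\in E(G)$ the edges of $H$ between $L(u)$ and $L(v)$ form a matching. The cover is $m$-fold if $|L(v)|=m$ for all $v$. An $\mathcal{H}$-coloring of $G$ is an independent set of $H$ of size $|V(G)|$; $P_{DP}(G,\mathcal{H})$ is the number of $\mathcal{H}$-colorings, and $P(G,m)$ is the chromatic polynomial (number of proper colorings $V(G)\to[m]$). Let $\mathcal{H}_{G,m}=(L_{G,m},H_{G,m})$ be the $m$-fold cover with $L_{G,m}(u)=\{(u,i):i\in[m]\}$ and, for each edge $uv\in E(G)$, the edges between $L_{G,m}(u)$ and $L_{G,m}(v)$ being exactly $\{(u,i)(v,i):i\in[m]\}$. $DP^*$ is the set of graphs $G$ for which there exists $M\in\mathbb{N}$ such that for every integer $m\ge M$ and every $m$-fold cover $\mathcal{H}=(L,H)$ of $G$ with $H\not\cong H_{G,m}$, we have $P_{DP}(G,\mathcal{H})>P(G,m)$. For an edge $e$ of $G$, let $\mathcal{C}_G(e)$ be the set of cycles of $G$ containing $e$ of minimum length, and let the girth $\ell_G(e)$ of $e$ be the length of the cycles in $\mathcal{C}_G(e)$ if this set is nonempty,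 and $\ell_G(e)=\infty$ otherwise. A graph $G$ is DP-good if $G$ has a spanning tree $T$ and a labeling $e_1,\dots,e_q$ of the edges of $E(G)\setminus E(T)$ (where $q=|E(G)|-|E(T)|$) such that $\ell_G(e_1)\le\cdots\le\ell_G(e_q)$ and for each $i\in[q]$, $\ell_G(e_i)$ is odd and there is some $C_i\in\mathcal{C}_G(e_i)$ with $E(C_i)\subseteq E(T)\cup\{e_1,\dots,e_i\}$. -}

module Defs where

open import Data.Nat using (ℕ; zero; suc; _+_; _≤_; _<_)
open import Data.Bool using (Bool; true; false; _∧_; _∨_; not; if_then_else_)
open import Data.Fin using (Fin; zero; suc; toℕ; inject₁; fromℕ; _≟_)
import Data.Fin as F
open import Data.Product using (Σ; ∃; ∃-syntax; _×_; _,_; proj₁; proj₂)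
open import Data.Sum using (_⊎_)
open import Data.List using (List; []; _∷_; map; concatMap; length; filter; allFin)
open import Relation.Nullary using (¬_; ⌊_⌋)
open import Relation.Binary.PropositionalEquality using (_≡_; _≢_)
open import Function.Bundles using (_↔_; Inverse)
open import Function.Definitions using (Injective)
import Data.Nat as N

Odd : ℕ → Set
Odd l = ∃[ t ] l ≡ suc (t + t)

record Graph (n : ℕ) : Set where
  field
    adj     : Fin n → Fin n → Bool
    symm    : ∀ u v → adj u v ≡ adj v u
    irrefl  : ∀ u → adj u u ≡ false
open Graph public

allF : (k : ℕ) → (Fin k → Bool) → Bool
allF zero    p = true
allF (suc k) p = p zero ∧ allF k (λ i → p (suc i))

sumF : (k : ℕ) → (Fin k → ℕ) → ℕ
sumF zero    f = 0
sumF (suc k) f = f zero + sumF k (λ i → f (suc i))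

allFuns : {A : Set} → List A → (k : ℕ) → List (Fin k → A)
allFuns xs zero    = (λ ()) ∷ []
allFuns xs (suc k) =
  concatMap (λ a → map (λ f → λ { zero → a ; (suc i) → f i }) (allFuns xs k)) xs

count : {A : Set} → (A → Bool) → List A → ℕ
count p xs = length (filter (λ x → p x Data.Bool.≟ true) xs)
  where import Data.Bool

_==ᶠ_ : {k : ℕ} → Fin k → Fin k → Bool
i ==ᶠ j = ⌊ i ≟ j ⌋

isProper : {n m : ℕ} → Graph n → (Fin n → Fin m) → Bool
isProper {n} G f =
  allF n (λ u → allF n (λ v → not (adj G u v ∧ (f u ==ᶠ f v))))

P : {n : ℕ} → Graph n → (m : ℕ) → ℕ
P {n} G m = count (isProper G) (allFuns (allFin m) n)

-- m-fold covers.  Up to isomorphism of covers, the vertex set of H is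
-- V(G) × [m] with L(u) = {(u,i) : i ∈ [m]}.  Each L(u) is a clique;
-- between L(u) and L(v) the edges are given by `match u v`, which is
-- empty unless uv ∈ E(G), symmetric, and a matching.

record Cover {n : ℕ} (G : Graph n) (m : ℕ) : Set where
  field
    match     : Fin n → Fin n → Fin m → Fin m → Bool
    match-adj : ∀ u v i j → match u v i j ≡ true → adj G u v ≡ true
    match-sym : ∀ u v i j → match u v i j ≡ match v u j i
    match-fun : ∀ u v i j j' → match u v i j ≡ true → match u v i j' ≡ true → j ≡ j'
open Cover public

hAdj : {n m : ℕ} {G : Graph n} → Cover G m → Fin n × Fin m → Fin n × Fin m → Bool
hAdj H (u , i) (v , j) = ((u ==ᶠ v) ∧ not (i ==ᶠ j)) ∨ match H u v i j

canonicalCover : {n : ℕ} (G : Graph n) (m : ℕ) → Cover G m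
canonicalCover G m = record
  { match     = λ u v i j → adj G u v ∧ (i ==ᶠ j)
  ; match-adj = adjLem
  ; match-sym = symLem
  ; match-fun = funLem
  }
  where
  open import Data.Bool.Properties using (∧-comm)
  open import Relation.Binary.PropositionalEquality using (refl; sym; trans; cong₂)
  open import Relation.Nullary using (yes; no)
  adjLem : ∀ u v i j → adj G u v ∧ (i ==ᶠ j) ≡ true → adj G u v ≡ true
  adjLem u v i j e with adj G u v
  ... | true  = refl
  ... | false = e
  eqSym : ∀ {k} (i j : Fin k) → (i ==ᶠ j) ≡ (j ==ᶠ i)
  eqSym i j with i ≟ j | j ≟ i
  ... | yes _ | yes _ = refl
  ... | no _  | no _  = refl
  ... | yes p | no q  = Data.Empty.⊥-elim (q (sym p)) where import Data.Empty
  ... | no p  | yes q = Data.Empty.⊥-elim (p (sym q)) where import Data.Empty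
  symLem : ∀ u v i j → adj G u v ∧ (i ==ᶠ j) ≡ adj G v u ∧ (j ==ᶠ i)
  symLem u v i j = cong₂ _∧_ (symm G u v) (eqSym i j)
  eqLem : ∀ {k} (i j : Fin k) → (i ==ᶠ j) ≡ true → i ≡ j
  eqLem i j e with i ≟ j
  ... | yes p = p
  ... | no _  = Data.Empty.⊥-elim (falseTrue e) where
    import Data.Empty
    falseTrue : false ≡ true → Data.Empty.⊥
    falseTrue ()
  andR : ∀ a b → a ∧ b ≡ true → b ≡ true
  andR true b e = e
  andR false b ()
  funLem : ∀ u v i j j' → adj G u v ∧ (i ==ᶠ j) ≡ true → adj G u v ∧ (i ==ᶠ j') ≡ true → j ≡ j'
  funLem u v i j j' e e' =
    trans (sym (eqLem i j (andR _ _ e))) (eqLem i j' (andR _ _ e'))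

CoverGraphIso : {n m : ℕ} {G : Graph n} → Cover G m → Cover G m → Set
CoverGraphIso {n} {m} H H' =
  Σ ((Fin n × Fin m) ↔ (Fin n × Fin m)) λ σ →
    ∀ x y → hAdj H x y ≡ hAdj H' (Inverse.to σ x) (Inverse.to σ y)

Subset : ℕ → ℕ → Set
Subset n m = Fin n → Fin m → Bool

isIndependent : {n m : ℕ} {G : Graph n} → Cover G m → Subset n m → Bool
isIndependent {n} {m} H S =
  allF n λ u → allF m λ i → allF n λ v → allF m λ j →
    not (S u i ∧ S v j ∧ hAdj H (u , i) (v , j))

size : {n m : ℕ} → Subset n m → ℕ
size {n} {m} S = sumF n λ u → sumF m λ i → if S u i then 1 else 0

allSubsets : (n m : ℕ) → List (Subset n m)
allSubsets n m = allFuns (allFuns (true ∷ false ∷ []) m) n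

PDP : {n m : ℕ} {G : Graph n} → Cover G m → ℕ
PDP {n} {m} H =
  count (λ S → isIndependent H S ∧ ⌊ size S N.≟ n ⌋) (allSubsets n m)

DPStar : {n : ℕ} → Graph n → Set
DPStar G = ∃[ M ] ∀ (m : ℕ) → M ≤ m → (H : Cover G m) →
  ¬ CoverGraphIso H (canonicalCover G m) → P G m < PDP H

record Cycle {n : ℕ} (R : Fin n → Fin n → Bool) : Set where
  field
    k      : ℕ
    k≥2    : 2 ≤ k
    vs     : Fin (suc k) → Fin n
    inj    : Injective _≡_ _≡_ vs
    steps  : ∀ (i : Fin k) → R (vs (inject₁ i)) (vs (suc i)) ≡ true
    close  : R (vs (fromℕ k)) (vs zero) ≡ true
open Cycle public

len : {n : ℕ} {R : Fin n → Fin n → Bool} → Cycle R → ℕ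
len C = suc (k C)

data Step {n : ℕ} {R : Fin n → Fin n → Bool} (C : Cycle R) : Fin n → Fin n → Set where
  mid   : (i : Fin (k C)) → Step C (vs C (inject₁ i)) (vs C (suc i))
  wrap  : Step C (vs C (fromℕ (k C))) (vs C zero)

CycleEdge : {n : ℕ} {R : Fin n → Fin n → Bool} → Cycle R → Fin n → Fin n → Set
CycleEdge C u v = Step C u v ⊎ Step C v u

MinCycleThrough : {n : ℕ} (G : Graph n) → Fin n → Fin n → Cycle (adj G) → Set
MinCycleThrough G u v C =
  CycleEdge C u v × (∀ (C' : Cycle (adj G)) → CycleEdge C' u v → len C ≤ len C')

data Walk {n : ℕ} (R : Fin n → Fin n → Bool) : Fin n → Fin n → Set where
  here : ∀ {u} → Walk R u u
  step : ∀ {u v w} → R u v ≡ true → Walk R v w → Walk R u w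

record SpanningTree {n : ℕ} (G : Graph n) : Set where
  field
    tadj      : Fin n → Fin n → Bool
    tsymm     : ∀ u v → tadj u v ≡ tadj v u
    sub       : ∀ u v → tadj u v ≡ true → adj G u v ≡ true
    connected : ∀ u v → Walk tadj u v
    acyclic   : ¬ Cycle tadj
open SpanningTree public

-- DP-good.  The edges of E(G) ∖ E(T) are labelled e_1,…,e_q (here indices
-- Fin q), each edge written as an ordered pair (a , b) with a < b.
-- Together with each e_i we give the cycle C_i ∈ 𝒞_G(e_i); its length is
-- ℓ_G(e_i).

record DPGoodWitness {n : ℕ} (G : Graph n) : Set where
  field
    T      : SpanningTree G
    q      : ℕ
    e      : Fin q → Fin n × Fin n
    e-ord  : ∀ i → proj₁ (e i) F.< proj₂ (e i)
    e-edge : ∀ i → adj G (proj₁ (e i)) (proj₂ (e i)) ≡ true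
    e-nonT : ∀ i → tadj T (proj₁ (e i)) (proj₂ (e i)) ≡ false
    e-inj  : Injective _≡_ _≡_ e
    e-surj : ∀ a b → a F.< b → adj G a b ≡ true → tadj T a b ≡ false →
             ∃[ i ] e i ≡ (a , b)
    C      : (i : Fin q) → Cycle (adj G)
    C-min  : ∀ i → MinCycleThrough G (proj₁ (e i)) (proj₂ (e i)) (C i)
    sorted : ∀ i j → toℕ i ≤ toℕ j → len (C i) ≤ len (C j)
    odd    : ∀ i → Odd (len (C i))
    inside : ∀ i a b → CycleEdge (C i) a b →
             tadj T a b ≡ true ⊎
             ∃[ j ] (toℕ j ≤ toℕ i × (e j ≡ (a , b) ⊎ e j ≡ (b , a)))

DPGood : {n : ℕ} → Graph n → Set
DPGood G = DPGoodWitness G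

module Submission where

-- Extend the matchings of a cover to permutations and choose coordinates in which they are the identity on the
-- spanning tree T. If they are then the identity on all edges, the cover is part of the canonical one and lacks
-- an edge, which gives an additional colouring. Otherwise expand both counts by inclusion–exclusion over edge
-- sets A: the difference PDP − P is the sum of the deficits D(A) = N ι A ∸ N σ A, with the sign + for |A| odd
-- and − for |A| even, where N counts the functions along which every edge of A is matched.
--
-- Let d j be the number of points moved at e j and ℓ j the length of C j. If A contains a cycle through e j, then
-- N ι A ≤ m ^ (n − ℓ j + 1), and for |A| even this improves to m ^ (n − ℓ j), since an odd cycle of minimal length
-- through e j has no chord. Hence the negative terms are at most a constant times the maximum over j of
-- d j * m ^ (n − ℓ j) / m. If i attains that maximum up to constants, and the earlier d j are small against d i whenever
-- ℓ j = ℓ i, then the edge set of C i has a deficit of at least d i * m ^ (n − ℓ i) / 2, which wins for large m.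

open import Defs
open import Data.Bool using (Bool; true; false; _∧_; _∨_; not; if_then_else_)
import Data.Bool as Bool
open import Data.Bool.Properties using (¬-not; not-involutive)
open import Data.Fin using (Fin; zero; suc; toℕ; inject₁; inject≤; fromℕ; _≟_)
import Data.Fin as Fin
open import Data.Fin.Permutation using (Permutation′; _⟨$⟩ʳ_; _⟨$⟩ˡ_; inverseˡ; inverseʳ; id; flip; _∘ₚ_; transpose)
import Data.Fin.Properties as Fin
open import Data.List using (List; []; _∷_; _++_; map; concatMap; filter; length; allFin; cartesianProduct)
import Data.List as List
open import Data.List.Membership.Propositional using (_∈_; _∉_; find; lose)
open import Data.List.Membership.Propositional.Properties
open import Data.List.Properties using (length-++; length-map; length-tabulate; map-tabulate)
open import Data.List.Relation.Binary.Sublist.Propositional as Sublist using ([]; _∷_; _∷ʳ_)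
import Data.List.Relation.Binary.Sublist.Propositional.Properties as Sublist
open import Data.List.Relation.Unary.All using (All; []; _∷_; all?)
import Data.List.Relation.Unary.All as All
open import Data.List.Relation.Unary.All.Properties using (¬Any⇒All¬; All¬⇒¬Any; ¬All⇒Any¬)
open import Data.List.Relation.Unary.AllPairs using ([]; _∷_)
open import Data.List.Relation.Unary.Any using (Any; here; there; any?; index)
import Data.List.Relation.Unary.Any as Any
open import Data.List.Relation.Unary.Any.Properties using (lookup-index)
open import Data.List.Relation.Unary.Unique.Propositional using (Unique)
import Data.List.Relation.Unary.Unique.Propositional.Properties as Unique
open import Data.Nat using (ℕ; zero; suc; _+_; _*_; _^_; _∸_; _≤_; _<_; z≤n; s≤s; NonZero; >-nonZero)
import Data.Nat.Properties as ℕ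
open import Data.Nat.Tactic.RingSolver using (solve-∀)
open import Data.Product using (Σ; ∃; _×_; _,_; proj₁; proj₂)
open import Data.Product.Properties using (≡-dec)
open import Data.Sum using (_⊎_; inj₁; inj₂; [_,_]′)
open import Data.Vec using (Vec; []; _∷_; lookup; tabulate; replicate; _[_]≔_)
open import Data.Vec.Functional using () renaming (_∷_ to _∷ᶠ_)
open import Data.Vec.Properties using (lookup∘tabulate; lookup∘update′; lookup-replicate)
open import Function using (_∘_; mk↔ₛ′)
open import Relation.Binary using (tri<; tri≈; tri>)
open import Relation.Binary.PropositionalEquality
open import Relation.Nullary using (Dec; yes; no; ¬_; ¬?; ⌊_⌋; contradiction; _×-dec_; decidable-stable)

-- The girths alone do not tell which edge decides the comparison. The twists depend on the cover,
-- and a strongly twisted edge with long cycles can outweigh a slightly twisted one with short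
-- cycles. Hence `i` is chosen anew for each cover, by maximising a weight, while all constants
-- depend only on `G` and its witness. The chosen `i` serves two purposes. Its term must bound the
-- terms of all other edges, and its twist must not be undone by the other twists around `C i`. The
-- other edges of `C i` lie in the tree, where nothing is moved, or come earlier in the labelling,
-- where the cycles are at most as long. A larger constant factor in the weight of earlier edges
-- serves both ends: an earlier edge that is not far less twisted than `e i` would have had the
-- larger weight. There is neither subtraction nor division of counts. Negative terms stand on the
-- other side of an inequality, frequencies such as `d / m` appear multiplied by `m`, and a count of
-- the form `m ^ (n - k)` is often stated through its product with `m ^ k`.

private variable
  A B D : Set
  m n : ℕ

-- Finite sums and indicators

∑ : List A → (A → ℕ) → ℕ
∑ []       h = 0
∑ (x ∷ xs) h = h x + ∑ xs h

∑-mono : (xs : List A) {h g : A → ℕ} → (∀ {x} → x ∈ xs → h x ≤ g x) → ∑ xs h ≤ ∑ xs g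
∑-mono []       le = z≤n
∑-mono (x ∷ xs) le = ℕ.+-mono-≤ (le (here refl)) (∑-mono xs (le ∘ there))

∑-cong : (xs : List A) {h g : A → ℕ} → (∀ x → h x ≡ g x) → ∑ xs h ≡ ∑ xs g
∑-cong []       eq = refl
∑-cong (x ∷ xs) eq = cong₂ _+_ (eq x) (∑-cong xs eq)

∑-+ : (xs : List A) (h g : A → ℕ) → ∑ xs (λ x → h x + g x) ≡ ∑ xs h + ∑ xs g
∑-+ []       h g = refl
∑-+ (x ∷ xs) h g rewrite ∑-+ xs h g = interchange (h x) (g x) (∑ xs h) (∑ xs g)
  where
  interchange : ∀ a b c d → a + b + (c + d) ≡ a + c + (b + d)
  interchange = solve-∀

∑-* : (c : ℕ) (xs : List A) (h : A → ℕ) → ∑ xs (λ x → c * h x) ≡ c * ∑ xs h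
∑-* c []       h = sym (ℕ.*-zeroʳ c)
∑-* c (x ∷ xs) h rewrite ∑-* c xs h = sym (ℕ.*-distribˡ-+ c (h x) (∑ xs h))

∑-const : (xs : List A) (c : ℕ) → ∑ xs (λ _ → c) ≡ length xs * c
∑-const []       c = refl
∑-const (x ∷ xs) c = cong (c +_) (∑-const xs c)

∑-bounded : (xs : List A) {h : A → ℕ} {c : ℕ} → (∀ {x} → x ∈ xs → h x ≤ c) → ∑ xs h ≤ length xs * c
∑-bounded xs {c = c} le = ℕ.≤-trans (∑-mono xs le) (ℕ.≤-reflexive (∑-const xs c))

∑-zero : (xs : List A) → ∑ xs (λ _ → 0) ≡ 0
∑-zero xs = trans (∑-const xs 0) (ℕ.*-zeroʳ (length xs))

∑-swap : (xs : List A) (ys : List B) (h : A → B → ℕ) →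
         ∑ xs (λ x → ∑ ys (h x)) ≡ ∑ ys (λ y → ∑ xs (λ x → h x y))
∑-swap []       ys h = sym (∑-zero ys)
∑-swap (x ∷ xs) ys h =
  trans (cong (∑ ys (h x) +_) (∑-swap xs ys h)) (sym (∑-+ ys (h x) _))

∑-++ : (xs ys : List A) (h : A → ℕ) → ∑ (xs ++ ys) h ≡ ∑ xs h + ∑ ys h
∑-++ []       ys h = refl
∑-++ (x ∷ xs) ys h rewrite ∑-++ xs ys h = sym (ℕ.+-assoc (h x) _ _)

∑-map : (g : A → B) (xs : List A) (h : B → ℕ) → ∑ (map g xs) h ≡ ∑ xs (h ∘ g)
∑-map g []       h = refl
∑-map g (x ∷ xs) h = cong (h (g x) +_) (∑-map g xs h)

∑-concatMap : (g : A → List B) (xs : List A) (h : B → ℕ) →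
              ∑ (concatMap g xs) h ≡ ∑ xs (λ x → ∑ (g x) h)
∑-concatMap g []       h = refl
∑-concatMap g (x ∷ xs) h =
  trans (∑-++ (g x) (concatMap g xs) h) (cong (∑ (g x) h +_) (∑-concatMap g xs h))

∑-member : {xs : List A} {x : A} (h : A → ℕ) → x ∈ xs → h x ≤ ∑ xs h
∑-member h (here refl) = ℕ.m≤m+n _ _
∑-member h (there i)   = ℕ.≤-trans (∑-member h i) (ℕ.m≤n+m _ _)

∑-strict : (xs : List A) {h g : A → ℕ} {x : A} →
           (∀ y → h y ≤ g y) → x ∈ xs → h x < g x → ∑ xs h < ∑ xs g
∑-strict (y ∷ xs) le (here refl) lt = ℕ.+-mono-<-≤ lt (∑-mono xs (λ {z} _ → le z))
∑-strict (y ∷ xs) le (there i)   lt = ℕ.+-mono-≤-< (le y) (∑-strict xs le i lt)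

𝟙 : Dec A → ℕ
𝟙 (yes _) = 1
𝟙 (no _)  = 0

𝟙-mono : (p : Dec A) (q : Dec B) → (A → B) → 𝟙 p ≤ 𝟙 q
𝟙-mono (yes a) (yes b) f = ℕ.≤-refl
𝟙-mono (yes a) (no ¬b) f = contradiction (f a) ¬b
𝟙-mono (no ¬a) q       f = z≤n

𝟙-cong : (p : Dec A) (q : Dec B) → (A → B) → (B → A) → 𝟙 p ≡ 𝟙 q
𝟙-cong p q f g = ℕ.≤-antisym (𝟙-mono p q f) (𝟙-mono q p g)

𝟙-yes : (p : Dec A) → A → 𝟙 p ≡ 1
𝟙-yes (yes _) a = refl
𝟙-yes (no ¬a) a = contradiction a ¬a

𝟙-no : (p : Dec A) → ¬ A → 𝟙 p ≡ 0
𝟙-no (yes a) ¬a = contradiction a ¬a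
𝟙-no (no _)  ¬a = refl

𝟙-× : (p : Dec A) (q : Dec B) → 𝟙 (p ×-dec q) ≡ 𝟙 p * 𝟙 q
𝟙-× (yes _) (yes _) = refl
𝟙-× (yes _) (no _)  = refl
𝟙-× (no _)  _       = refl

𝟙-¬ : (p : Dec A) → 𝟙 p + 𝟙 (¬? p) ≡ 1
𝟙-¬ (yes _) = refl
𝟙-¬ (no _)  = refl

𝟙-⊎ : (p : Dec A) (q : Dec B) (r : Dec D) → (A → B ⊎ D) → 𝟙 p ≤ 𝟙 q + 𝟙 r
𝟙-⊎ (no _)  q r f = z≤n
𝟙-⊎ (yes a) q r f with f a
... | inj₁ b = ℕ.≤-trans (ℕ.≤-reflexive (sym (𝟙-yes q b))) (ℕ.m≤m+n _ _)
... | inj₂ c = ℕ.≤-trans (ℕ.≤-reflexive (sym (𝟙-yes r c))) (ℕ.m≤n+m _ _)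

𝟙-any : (p : Dec A) {Q : B → Set} (q : ∀ x → Dec (Q x)) (xs : List B) →
        (A → Any Q xs) → 𝟙 p ≤ ∑ xs (𝟙 ∘ q)
𝟙-any (no _)  q xs f = z≤n
𝟙-any (yes a) q xs f = go xs (f a)
  where
  go : ∀ xs → Any _ xs → 1 ≤ ∑ xs (𝟙 ∘ q)
  go (x ∷ xs) (here px) = ℕ.≤-trans (ℕ.≤-reflexive (sym (𝟙-yes (q x) px))) (ℕ.m≤m+n _ _)
  go (x ∷ xs) (there i) = ℕ.≤-trans (go xs i) (ℕ.m≤n+m _ _)

∑-δ : (m : ℕ) (c : Fin m) (h : Fin m → ℕ) → ∑ (allFin m) (λ y → 𝟙 (y ≟ c) * h y) ≡ h c
∑-δ m c h = go (Unique.allFin⁺ m) (∈-allFin c)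
  where
  off : ∀ {xs} → All (λ y → y ≢ c) xs → ∑ xs (λ y → 𝟙 (y ≟ c) * h y) ≡ 0
  off []                      = refl
  off {y ∷ xs} (y≢c ∷ rest) rewrite 𝟙-no (y ≟ c) y≢c = off rest
  go : ∀ {xs} → Unique xs → c ∈ xs → ∑ xs (λ y → 𝟙 (y ≟ c) * h y) ≡ h c
  go {y ∷ xs} (y∉ ∷ u) (here refl)
    rewrite 𝟙-yes (c ≟ c) refl | off (All.map (λ ne e → ne (sym e)) y∉) =
    trans (ℕ.+-identityʳ _) (ℕ.+-identityʳ _)
  go {y ∷ xs} (y∉ ∷ u) (there i) rewrite 𝟙-no (y ≟ c) (All.lookup y∉ i) = go u i

length-allFin : ∀ m → length (allFin m) ≡ m
length-allFin m = length-tabulate {n = m} (λ i → i)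

-- Each value is written as a sum against a delta. After the two sums are exchanged, the delta is
-- read through the inverse of `π`, so no list has to be rearranged.
∑-perm : (π : Permutation′ m) (h : Fin m → ℕ) → ∑ (allFin m) (h ∘ (π ⟨$⟩ʳ_)) ≡ ∑ (allFin m) h
∑-perm {m} π h = begin
  ∑ F (λ x → h (π ⟨$⟩ʳ x))                           ≡⟨ ∑-cong F (λ x → sym (∑-δ m (π ⟨$⟩ʳ x) h)) ⟩
  ∑ F (λ x → ∑ F (λ y → 𝟙 (y ≟ (π ⟨$⟩ʳ x)) * h y))    ≡⟨ ∑-swap F F _ ⟩
  ∑ F (λ y → ∑ F (λ x → 𝟙 (y ≟ (π ⟨$⟩ʳ x)) * h y))    ≡⟨ ∑-cong F (λ y → ∑-cong F (λ x →
                                                        cong (_* h y) (𝟙-cong (y ≟ _) (x ≟ (π ⟨$⟩ˡ y)) (to x y) (from x y)))) ⟩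
  ∑ F (λ y → ∑ F (λ x → 𝟙 (x ≟ (π ⟨$⟩ˡ y)) * h y))    ≡⟨ ∑-cong F (λ y → ∑-δ m (π ⟨$⟩ˡ y) (λ _ → h y)) ⟩
  ∑ F h                                              ∎
  where
  open ≡-Reasoning
  F = allFin m
  to : ∀ x y → y ≡ (π ⟨$⟩ʳ x) → x ≡ (π ⟨$⟩ˡ y)
  to x _ refl = sym (inverseˡ π)
  from : ∀ x y → x ≡ (π ⟨$⟩ˡ y) → y ≡ (π ⟨$⟩ʳ x)
  from _ y refl = sym (inverseʳ π)

-- Colour assignments as vectors

vecs : List A → (n : ℕ) → List (Vec A n)
vecs xs zero    = [] ∷ []
vecs xs (suc n) = concatMap (λ a → map (a ∷_) (vecs xs n)) xs

∑-vecs : (xs : List A) (n : ℕ) (h : Vec A (suc n) → ℕ) →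
         ∑ (vecs xs (suc n)) h ≡ ∑ xs (λ a → ∑ (vecs xs n) (λ f → h (a ∷ f)))
∑-vecs xs n h =
  trans (∑-concatMap _ xs h) (∑-cong xs (λ a → ∑-map (a ∷_) (vecs xs n) h))

length-vecs : (m n : ℕ) → length (vecs (allFin m) n) ≡ m ^ n
length-vecs m n = trans (sym (ℕ.*-identityʳ _)) (trans (sym (∑-const (vecs (allFin m) n) 1)) (go n))
  where
  go : ∀ n → ∑ (vecs (allFin m) n) (λ _ → 1) ≡ m ^ n
  go zero    = refl
  go (suc n) = trans (∑-vecs (allFin m) n _)
    (trans (∑-cong (allFin m) (λ _ → go n))
    (trans (∑-const (allFin m) (m ^ n)) (cong (_* m ^ n) (length-allFin m))))

∈-vecs : {xs : List A} (f : Vec A n) → (∀ i → lookup f i ∈ xs) → f ∈ vecs xs n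
∈-vecs []      _ = here refl
∈-vecs (a ∷ f) i = ∈-concatMap⁺ _ (Any.map (λ { refl → ∈-map⁺ (a ∷_) (∈-vecs f (i ∘ suc)) }) (i zero))

act : (Fin n → Permutation′ m) → Vec (Fin m) n → Vec (Fin m) n
act π f = tabulate (λ v → π v ⟨$⟩ʳ lookup f v)

∑-act : (π : Fin n → Permutation′ m) (h : Vec (Fin m) n → ℕ) →
        ∑ (vecs (allFin m) n) (h ∘ act π) ≡ ∑ (vecs (allFin m) n) h
∑-act {zero}  π h = refl
∑-act {suc n} {m} π h = begin
  ∑ (vecs F (suc n)) (h ∘ act π)
    ≡⟨ ∑-vecs F n _ ⟩
  ∑ F (λ a → ∑ (vecs F n) (λ f → h ((π zero ⟨$⟩ʳ a) ∷ act (π ∘ suc) f)))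
    ≡⟨ ∑-cong F (λ a → ∑-act (π ∘ suc) (λ f → h ((π zero ⟨$⟩ʳ a) ∷ f))) ⟩
  ∑ F (λ a → ∑ (vecs F n) (λ f → h ((π zero ⟨$⟩ʳ a) ∷ f)))
    ≡⟨ ∑-perm (π zero) (λ a → ∑ (vecs F n) (λ f → h (a ∷ f))) ⟩
  ∑ F (λ a → ∑ (vecs F n) (λ f → h (a ∷ f)))
    ≡⟨ ∑-vecs F n h ⟨
  ∑ (vecs F (suc n)) h ∎
  where
  open ≡-Reasoning
  F = allFin m

-- Neither `h` nor `φ` sees the coordinate `p`, so exactly one of its `m` values meets the
-- constraint. Every power of `m` in the later counts comes from such an equation on a fresh
-- coordinate.
determined : (p : Fin n) (h : Vec (Fin m) n → ℕ) (φ : Vec (Fin m) n → Fin m) →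
             (∀ f x → h (f [ p ]≔ x) ≡ h f) → (∀ f x → φ (f [ p ]≔ x) ≡ φ f) →
             m * ∑ (vecs (allFin m) n) (λ f → 𝟙 (lookup f p ≟ φ f) * h f) ≡ ∑ (vecs (allFin m) n) h
-- Separated because the next clause needs `zero : Fin m` as a sample value for the free coordinate.
determined {suc n} {zero} zero h φ hp φp = refl
determined {suc n} {m@(suc k)} zero h φ hp φp = begin
  m * ∑ (vecs F (suc n)) (λ f → 𝟙 (lookup f zero ≟ φ f) * h f)
    ≡⟨ cong (m *_) (trans (∑-vecs F n _) (∑-swap F (vecs F n) _)) ⟩
  m * ∑ (vecs F n) (λ f → ∑ F (λ a → 𝟙 (a ≟ φ (a ∷ f)) * h (a ∷ f)))
    ≡⟨ cong (m *_) (∑-cong (vecs F n) (λ f → trans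
         (∑-cong F (λ a → cong₂ (λ c d → 𝟙 (a ≟ c) * d) (φp (zero ∷ f) a) (hp (zero ∷ f) a)))
         (∑-δ m (φ (zero ∷ f)) (λ _ → h (zero ∷ f))))) ⟩
  m * ∑ (vecs F n) (λ f → h (zero ∷ f))
    ≡⟨ cong (_* ∑ (vecs F n) (λ f → h (zero ∷ f))) (length-allFin m) ⟨
  length F * ∑ (vecs F n) (λ f → h (zero ∷ f))
    ≡⟨ ∑-const F _ ⟨
  ∑ F (λ a → ∑ (vecs F n) (λ f → h (zero ∷ f)))
    ≡⟨ ∑-cong F (λ a → ∑-cong (vecs F n) (λ f → sym (hp (zero ∷ f) a))) ⟩
  ∑ F (λ a → ∑ (vecs F n) (λ f → h (a ∷ f)))
    ≡⟨ ∑-vecs F n h ⟨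
  ∑ (vecs F (suc n)) h ∎
  where
  open ≡-Reasoning
  F = allFin m
determined {suc n} {m} (suc p) h φ hp φp = begin
  m * ∑ (vecs F (suc n)) (λ f → 𝟙 (lookup f (suc p) ≟ φ f) * h f)
    ≡⟨ cong (m *_) (∑-vecs F n _) ⟩
  m * ∑ F (λ a → ∑ (vecs F n) (λ f → 𝟙 (lookup f p ≟ φ (a ∷ f)) * h (a ∷ f)))
    ≡⟨ ∑-* m F _ ⟨
  ∑ F (λ a → m * ∑ (vecs F n) (λ f → 𝟙 (lookup f p ≟ φ (a ∷ f)) * h (a ∷ f)))
    ≡⟨ ∑-cong F (λ a → determined p (h ∘ (a ∷_)) (φ ∘ (a ∷_)) (hp ∘ (a ∷_)) (φp ∘ (a ∷_))) ⟩
  ∑ F (λ a → ∑ (vecs F n) (λ f → h (a ∷ f)))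
    ≡⟨ ∑-vecs F n h ⟨
  ∑ (vecs F (suc n)) h ∎
  where
  open ≡-Reasoning
  F = allFin m

lookup-injective : {xs : List A} → Unique xs → ∀ {i j} → List.lookup xs i ≡ List.lookup xs j → i ≡ j
lookup-injective (_ ∷ _)  {zero}  {zero}  e = refl
lookup-injective (x∉ ∷ _) {zero}  {suc j} e = contradiction e (All.lookup x∉ (∈-lookup j))
lookup-injective (x∉ ∷ _) {suc i} {zero}  e = contradiction (sym e) (All.lookup x∉ (∈-lookup i))
lookup-injective (_ ∷ u)  {suc i} {suc j} e = cong suc (lookup-injective u e)

unique-⊆-length : {xs ys : List A} → Unique xs → (∀ {x} → x ∈ xs → x ∈ ys) → length xs ≤ length ys
unique-⊆-length {xs = xs} {ys} u sub = Fin.injective⇒≤ {f = λ i → index (sub (∈-lookup i))} λ {i} {j} e →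
  lookup-injective u (trans (lookup-index (sub (∈-lookup {xs = xs} i)))
    (trans (cong (List.lookup ys) e) (sym (lookup-index (sub (∈-lookup j))))))

unique-length≤ : {xs : List (Fin n)} → Unique xs → length xs ≤ n
unique-length≤ u = Fin.injective⇒≤ (lookup-injective u)

-- Inclusion–exclusion

-- The sublists of even length for false, of odd length for true.
subs : Bool → List A → List (List A)
subs b     (x ∷ E) = subs b E ++ map (x ∷_) (subs (not b) E)
subs false []      = [] ∷ []
subs true  []      = []

oddLength : List A → Bool
oddLength []      = false
oddLength (_ ∷ l) = not (oddLength l)

oddLength-odd : (xs : List A) (t : ℕ) → length xs ≡ suc (t + t) → oddLength xs ≡ true
oddLength-odd (_ ∷ [])     zero    e = refl
oddLength-odd (_ ∷ _ ∷ xs) (suc t) e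
  rewrite oddLength-odd xs t (ℕ.suc-injective (ℕ.suc-injective (trans e (cong (2 +_) (ℕ.+-suc t t))))) = refl

subs-sound : (b : Bool) (E : List A) {S : List A} → S ∈ subs b E → oddLength S ≡ b × S Sublist.⊆ E
subs-sound false []      (here refl) = refl , []
subs-sound b     (x ∷ E) S∈ with ∈-++⁻ (subs b E) S∈
... | inj₁ i = let e , s = subs-sound b E i in e , x ∷ʳ s
... | inj₂ i with S' , j , refl ← ∈-map⁻ (x ∷_) i =
  let e , s = subs-sound (not b) E j in trans (cong not e) (not-involutive b) , refl ∷ s

subs-complete : {S E : List A} → S Sublist.⊆ E → S ∈ subs (oddLength S) E
subs-complete []                       = here refl
subs-complete {S = S} (x ∷ʳ s)         = ∈-++⁺ˡ (subs-complete s)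
subs-complete {S = x ∷ S} {_ ∷ E} (refl ∷ s) = ∈-++⁺ʳ (subs (not (oddLength S)) E) (∈-map⁺ (x ∷_)
  (subst (λ b → S ∈ subs b E) (sym (not-involutive (oddLength S))) (subs-complete s)))

length-subs : (b : Bool) (E : List A) → length (subs b E) ≤ 2 ^ length E
length-subs false []      = ℕ.≤-refl
length-subs true  []      = z≤n
length-subs b     (x ∷ E) = begin
  length (subs b E ++ map (x ∷_) (subs (not b) E))
    ≡⟨ trans (length-++ (subs b E)) (cong (length (subs b E) +_) (length-map (x ∷_) (subs (not b) E))) ⟩
  length (subs b E) + length (subs (not b) E)
    ≤⟨ ℕ.+-mono-≤ (length-subs b E) (ℕ.≤-trans (length-subs (not b) E) (ℕ.m≤m+n _ 0)) ⟩
  2 * 2 ^ length E ∎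
  where open ℕ.≤-Reasoning

𝟙-all-∷ : {Q : A → Set} (q : ∀ x → Dec (Q x)) (x : A) (xs : List A) →
          𝟙 (all? q (x ∷ xs)) ≡ 𝟙 (q x) * 𝟙 (all? q xs)
𝟙-all-∷ q x xs = trans
  (𝟙-cong (all? q (x ∷ xs)) (q x ×-dec all? q xs) (λ { (a ∷ b) → a , b }) (λ { (a , b) → a ∷ b }))
  (𝟙-× (q x) (all? q xs))

-- This is the expansion of the product of the factors `1 - 𝟙 (q x)`, with its negative terms moved
-- to the left.
inclusion-exclusion : {Q : A → Set} (q : ∀ x → Dec (Q x)) (E : List A) →
  𝟙 (all? (¬? ∘ q) E) + ∑ (subs true E) (λ S → 𝟙 (all? q S)) ≡ ∑ (subs false E) (λ S → 𝟙 (all? q S))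
inclusion-exclusion q []      = refl
inclusion-exclusion q (x ∷ E) = trans
  (cong₂ _+_ (𝟙-all-∷ (¬? ∘ q) x E) (split true)) (trans combine (sym (split false)))
  where
  S : Bool → ℕ
  S b = ∑ (subs b E) (λ S → 𝟙 (all? q S))
  split : ∀ b → ∑ (subs b (x ∷ E)) (λ S → 𝟙 (all? q S)) ≡ S b + 𝟙 (q x) * S (not b)
  split false = trans (∑-++ (subs false E) _ _) (cong (S false +_) (trans (∑-map (x ∷_) (subs true E) _)
    (trans (∑-cong (subs true E) (𝟙-all-∷ q x)) (∑-* (𝟙 (q x)) (subs true E) _))))
  split true = trans (∑-++ (subs true E) _ _) (cong (S true +_) (trans (∑-map (x ∷_) (subs false E) _)
    (trans (∑-cong (subs false E) (𝟙-all-∷ q x)) (∑-* (𝟙 (q x)) (subs false E) _))))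
  IH = inclusion-exclusion q E
  combine : 𝟙 (¬? (q x)) * 𝟙 (all? (¬? ∘ q) E) + (S true + 𝟙 (q x) * S false) ≡ S false + 𝟙 (q x) * S true
  combine with q x
  ... | yes _ = trans (cong (S true +_) (ℕ.*-identityˡ _)) (trans (ℕ.+-comm (S true) _) (cong (S false +_) (sym (ℕ.*-identityˡ _))))
  ... | no _  = trans (cong₂ _+_ (ℕ.*-identityˡ (𝟙 (all? (¬? ∘ q) E))) (ℕ.+-identityʳ (S true))) (trans IH (sym (ℕ.+-identityʳ _)))

-- From counts over function lists to sums over vectors

count-∑ : (p : A → Bool) (xs : List A) → count p xs ≡ ∑ xs (λ x → 𝟙 (p x Bool.≟ true))
count-∑ p []       = refl
count-∑ p (x ∷ xs) with p x
... | true  = cong suc (count-∑ p xs)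
... | false = count-∑ p xs

-- The entries of `allFuns` are pattern-matching lambdas that equal `a ∷ᶠ f` only pointwise. The
-- hypothesis on `h` takes the place of function extensionality.
∑-allFuns-suc : (xs : List A) (n : ℕ) (h : (Fin (suc n) → A) → ℕ) →
                (∀ f g → (∀ i → f i ≡ g i) → h f ≡ h g) →
                ∑ (allFuns xs (suc n)) h ≡ ∑ xs (λ a → ∑ (allFuns xs n) (λ f → h (a ∷ᶠ f)))
∑-allFuns-suc xs n h ext = trans (∑-concatMap _ xs h) (∑-cong xs (λ a →
  trans (∑-map _ (allFuns xs n) h) (∑-cong (allFuns xs n) (λ f → ext _ _ (λ { zero → refl ; (suc i) → refl })))))

∑-allFuns : (xs : List A) (n : ℕ) (h : (Fin n → A) → ℕ) →
            (∀ f g → (∀ i → f i ≡ g i) → h f ≡ h g) →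
            ∑ (allFuns xs n) h ≡ ∑ (vecs xs n) (h ∘ lookup)
∑-allFuns xs zero    h ext = cong (_+ 0) (ext _ _ (λ ()))
∑-allFuns xs (suc n) h ext = begin
  ∑ (allFuns xs (suc n)) h
    ≡⟨ ∑-allFuns-suc xs n h ext ⟩
  ∑ xs (λ a → ∑ (allFuns xs n) (λ f → h (a ∷ᶠ f)))
    ≡⟨ ∑-cong xs (λ a → trans
         (∑-allFuns xs n _ (λ f g e → ext _ _ (λ { zero → refl ; (suc i) → e i })))
         (∑-cong (vecs xs n) (λ f → ext _ _ (λ { zero → refl ; (suc i) → refl })))) ⟩
  ∑ xs (λ a → ∑ (vecs xs n) (λ f → h (lookup (a ∷ f))))
    ≡⟨ ∑-vecs xs n (h ∘ lookup) ⟨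
  ∑ (vecs xs (suc n)) (h ∘ lookup) ∎
  where open ≡-Reasoning

-- Edges, paths and cycles

Edge : ℕ → Set
Edge n = Fin n × Fin n

Ordered : Edge n → Set
Ordered (u , v) = u Fin.< v

norm : Fin n → Fin n → Edge n
norm x y with x Fin.<? y
... | yes _ = x , y
... | no  _ = y , x

norm-ordered : {x y : Fin n} → x Fin.< y → norm x y ≡ (x , y)
norm-ordered {x = x} {y} x<y with x Fin.<? y
... | yes _  = refl
... | no x≮y = contradiction x<y x≮y

norm-comm : (x y : Fin n) → norm x y ≡ norm y x
norm-comm x y with x Fin.<? y | y Fin.<? x
... | yes p | yes q = contradiction q (Fin.<-asym p)
... | yes _ | no  _ = refl
... | no  _ | yes _ = refl
... | no  p | no  q = cong₂ _,_ (Fin.≤-antisym (ℕ.≮⇒≥ p) (ℕ.≮⇒≥ q)) (Fin.≤-antisym (ℕ.≮⇒≥ q) (ℕ.≮⇒≥ p))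

norm-cases : (x y : Fin n) → norm x y ≡ (x , y) ⊎ norm x y ≡ (y , x)
norm-cases x y with x Fin.<? y
... | yes _ = inj₁ refl
... | no  _ = inj₂ refl

norm-orders : {x y : Fin n} → x ≢ y → Ordered (norm x y)
norm-orders {x = x} {y} x≢y with Fin.<-cmp x y
... | tri< l _ _ = subst Ordered (sym (norm-ordered l)) l
... | tri≈ _ e _ = contradiction e x≢y
... | tri> _ _ g = subst Ordered (sym (trans (norm-comm x y) (norm-ordered g))) g

norm-≡ : {x y a b : Fin n} → norm x y ≡ (a , b) → (x ≡ a × y ≡ b) ⊎ (x ≡ b × y ≡ a)
norm-≡ {x = x} {y} e with norm-cases x y
... | inj₁ p with refl ← trans (sym p) e = inj₁ (refl , refl)
... | inj₂ p with refl ← trans (sym p) e = inj₂ (refl , refl)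

norm-injective : {x y a b : Fin n} → norm x y ≡ norm a b → (x ≡ a × y ≡ b) ⊎ (x ≡ b × y ≡ a)
norm-injective {a = a} {b} e with norm-cases a b
... | inj₁ p = norm-≡ (trans e p)
... | inj₂ p = [ inj₂ , inj₁ ]′ (norm-≡ (trans e p))

norm-elim : (Q : Fin n → Fin n → Set) → (∀ {a b} → Q a b → Q b a) → (x y : Fin n) →
            Q (proj₁ (norm x y)) (proj₂ (norm x y)) → Q x y
norm-elim Q Q-sym x y q with norm-cases x y
... | inj₁ p rewrite p = q
... | inj₂ p rewrite p = Q-sym q

norm-intro : (Q : Fin n → Fin n → Set) → (∀ {a b} → Q a b → Q b a) → (x y : Fin n) →
             Q x y → Q (proj₁ (norm x y)) (proj₂ (norm x y))
norm-intro Q Q-sym x y q with norm-cases x y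
... | inj₁ p rewrite p = q
... | inj₂ p rewrite p = Q-sym q

infixr 5 _∷_
data Chain (R : Fin n → Fin n → Set) : Fin n → List (Fin n) → Fin n → Set where
  [_] : ∀ x → Chain R x (x ∷ []) x
  _∷_ : ∀ {x y z xs} → R x y → Chain R y xs z → Chain R x (x ∷ xs) z

private variable
  R R′ : Fin n → Fin n → Set
  x y z w : Fin n
  xs ys : List (Fin n)

chain-map : (∀ {a b} → R a b → R′ a b) → Chain R x xs y → Chain R′ x xs y
chain-map f [ x ]   = [ x ]
chain-map f (r ∷ c) = f r ∷ chain-map f c

chain-++ : Chain R x xs y → R y z → Chain R z ys w → Chain R x (xs ++ ys) w
chain-++ [ _ ]   r d = r ∷ d
chain-++ (s ∷ c) r d = s ∷ chain-++ c r d

chain-head : Chain R x xs y → x ∈ xs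
chain-head [ _ ]   = here refl
chain-head (_ ∷ _) = here refl

chain-last : Chain R x xs y → y ∈ xs
chain-last [ _ ]   = here refl
chain-last (_ ∷ c) = there (chain-last c)

edges : Chain {n} R x xs y → List (Edge n)
edges [ _ ]                   = []
edges (_∷_ {x = x} {y} r c) = norm x y ∷ edges c

length-edges : (c : Chain R x xs y) → length xs ≡ suc (length (edges c))
length-edges [ _ ]   = refl
length-edges (_ ∷ c) = cong suc (length-edges c)

edges-all : {R : Fin n → Fin n → Set} {Q : Edge n → Set} → (∀ {a b} → R a b → Q (norm a b)) →
            (c : Chain R x xs y) → ∀ {e} → e ∈ edges c → Q e
edges-all f (r ∷ c) (here refl) = f r
edges-all f (r ∷ c) (there i)   = edges-all f c i

edges-ends : (c : Chain R x xs y) → ∀ {a b} → norm a b ∈ edges c → a ∈ xs × b ∈ xs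
edges-ends (r ∷ c) (here e) with norm-injective e
... | inj₁ (refl , refl) = here refl , there (chain-head c)
... | inj₂ (refl , refl) = there (chain-head c) , here refl
edges-ends (r ∷ c) (there i) = let p , q = edges-ends c i in there p , there q

edges-unique : (c : Chain R x xs y) → Unique xs → Unique (edges c)
edges-unique [ _ ]   u         = []
edges-unique (r ∷ c) (x∉ ∷ u) =
  ¬Any⇒All¬ _ (λ i → All¬⇒¬Any x∉ (proj₁ (edges-ends c i))) ∷ edges-unique c u

edges-split : (c : Chain R x xs y) → ∀ {e} → e ∈ edges c →
              ∃ λ a → ∃ λ b → ∃ λ ys → ∃ λ zs →
              xs ≡ ys ++ zs × e ≡ norm a b × Chain R x ys a × Chain R b zs y
edges-split (r ∷ c) (here refl) = _ , _ , _ , _ , refl , refl , [ _ ] , c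
edges-split (r ∷ c) (there i) with edges-split c i
... | a , b , ys , zs , refl , q , c₁ , c₂ = a , b , _ , zs , refl , q , r ∷ c₁ , c₂

edges-constant : {X : Set} (f : Fin n → X) (c : Chain R x xs y) →
                 (∀ {e} → e ∈ edges c → f (proj₁ e) ≡ f (proj₂ e)) →
                 ∀ {w} → w ∈ xs → f w ≡ f x
edges-constant f [ _ ]   k (here refl) = refl
edges-constant f (r ∷ c) k (here refl) = refl
edges-constant f (_∷_ {x = x} {y} r c) k (there i) =
  trans (edges-constant f c (k ∘ there) i)
        (sym (norm-elim (λ a b → f a ≡ f b) sym x y (k (here refl))))

-- Only the first edge of the path touches `x`, and with three vertices its other end is not yet
-- `y`. With two vertices the closing edge would be the path itself.
closing∉edges : (c : Chain R x xs y) → Unique xs → 3 ≤ length xs → norm x y ∉ edges c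
closing∉edges (r ∷ [ _ ]) _ (s≤s (s≤s ()))
closing∉edges (r ∷ s ∷ c) (x∉ ∷ y∉ ∷ u) _ (here e) with norm-injective e
... | inj₁ (_ , refl) = All¬⇒¬Any y∉ (chain-last c)
... | inj₂ (refl , _) = All¬⇒¬Any x∉ (here refl)
closing∉edges (r ∷ c) (x∉ ∷ u) _ (there i) = All¬⇒¬Any x∉ (proj₁ (edges-ends c i))

suffix : (c : Chain R x xs y) → Unique xs → ∀ {q} → q ∈ xs →
         q ≡ x ⊎ ∃ λ ws → Chain R q ws y × Unique ws × (∀ {w} → w ∈ ws → w ∈ xs) × length ws < length xs
suffix [ _ ]   u        (here refl) = inj₁ refl
suffix (r ∷ c) u        (here refl) = inj₁ refl
suffix (r ∷ c) (_ ∷ u) (there i) with suffix c u i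
... | inj₁ refl                    = inj₂ (_ , c , u , there , ℕ.≤-refl)
... | inj₂ (ws , d , u' , sub , l) = inj₂ (ws , d , u' , there ∘ sub , ℕ.m≤n⇒m≤1+n l)

∉⇒unique : x ∉ xs → Unique xs → Unique (x ∷ xs)
∉⇒unique x∉ u = ¬Any⇒All¬ _ x∉ ∷ u

-- The chord replaces the stretch between `p` and `q`, which loses a vertex unless the two are
-- consecutive. That the chord lies on the new path matters when this path is too short to close up
-- to a cycle: the chord is then its only edge.
shortcut : (c : Chain R x xs y) → Unique xs → ∀ {p q} → p ∈ xs → q ∈ xs → p ≢ q → R p q → R q p →
           norm p q ∈ edges c ⊎
           ∃ λ ws → Σ (Chain R x ws y) λ d →
             Unique ws × (∀ {w} → w ∈ ws → w ∈ xs) × length ws < length xs × norm p q ∈ edges d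
shortcut [ _ ]   u (here refl) (here refl) p≢q _ _ = contradiction refl p≢q
shortcut (r ∷ c) u (here refl) (here refl) p≢q _ _ = contradiction refl p≢q
shortcut (r ∷ c) (x∉ ∷ u) (here refl) (there j) p≢q pq qp with suffix c u j
... | inj₁ refl                    = inj₁ (here refl)
... | inj₂ (ws , d , u' , sub , l) =
  inj₂ (_ , pq ∷ d , ∉⇒unique (All¬⇒¬Any x∉ ∘ sub) u' ,
        (λ { (here e) → here e ; (there i) → there (sub i) }) , s≤s l , here refl)
shortcut (r ∷ c) (x∉ ∷ u) {p} {q} (there i) (here refl) p≢q pq qp with suffix c u i
... | inj₁ refl                    = inj₁ (here (norm-comm p q))
... | inj₂ (ws , d , u' , sub , l) =
  inj₂ (_ , qp ∷ d , ∉⇒unique (All¬⇒¬Any x∉ ∘ sub) u' ,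
        (λ { (here e) → here e ; (there i) → there (sub i) }) , s≤s l , here (norm-comm p q))
shortcut (r ∷ c) (x∉ ∷ u) (there i) (there j) p≢q pq qp with shortcut c u i j p≢q pq qp
... | inj₁ k                           = inj₁ (there k)
... | inj₂ (ws , d , u' , sub , l , k) =
  inj₂ (_ , r ∷ d , ∉⇒unique (All¬⇒¬Any x∉ ∘ sub) u' ,
        (λ { (here e) → here e ; (there i) → there (sub i) }) , s≤s l , there k)

chain-lookup : {B : Fin n → Fin n → Bool} → Chain (λ a b → B a b ≡ true) x (x ∷ xs) y →
               (i : Fin (length xs)) → B (List.lookup (x ∷ xs) (inject₁ i)) (List.lookup (x ∷ xs) (suc i)) ≡ true
chain-lookup (r ∷ [ _ ])     zero    = r
chain-lookup (r ∷ s ∷ c)     zero    = r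
chain-lookup (r ∷ s ∷ c)     (suc i) = chain-lookup (s ∷ c) i

chain-lookup-last : Chain R x (x ∷ xs) y → List.lookup (x ∷ xs) (fromℕ (length xs)) ≡ y
chain-lookup-last [ _ ]         = refl
chain-lookup-last (r ∷ [ _ ])   = refl
chain-lookup-last (r ∷ s ∷ c)   = chain-lookup-last (s ∷ c)

chain⇒cycle : {B : Fin n → Fin n → Bool} → Chain (λ a b → B a b ≡ true) x xs y → Unique xs →
              3 ≤ length xs → B y x ≡ true → Σ (Cycle B) λ C → len C ≡ length xs × Step C y x
chain⇒cycle [ _ ] _ (s≤s ())
chain⇒cycle {x = x} {xs = _ ∷ xs} {y = y} {B = B} c@(_ ∷ _) u (s≤s l) yx = C , refl , st
  where
  C : Cycle B
  C = record
    { k = length xs ; k≥2 = l ; vs = List.lookup (x ∷ xs) ; inj = lookup-injective u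
    ; steps = chain-lookup c ; close = subst (λ v → B v x ≡ true) (sym (chain-lookup-last c)) yx }
  st : Step C y x
  st = subst (λ v → Step C v x) (chain-lookup-last c) wrap

tabulate-chain : (k : ℕ) (g : Fin (suc k) → Fin n) → (∀ i → R (g (inject₁ i)) (g (suc i))) →
                 Chain R (g zero) (List.tabulate g) (g (fromℕ k))
tabulate-chain zero    g r = [ g zero ]
tabulate-chain (suc k) g r = r zero ∷ tabulate-chain k (g ∘ suc) (r ∘ suc)

tabulate-split : (k : ℕ) (g : Fin (suc k) → Fin n) → (∀ i → R (g (inject₁ i)) (g (suc i))) → (t : Fin k) →
                 ∃ λ ys → ∃ λ zs → List.tabulate g ≡ ys ++ zs ×
                 Chain R (g zero) ys (g (inject₁ t)) × Chain R (g (suc t)) zs (g (fromℕ k))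
tabulate-split (suc k) g r zero    = _ , _ , refl , [ g zero ] , tabulate-chain k (g ∘ suc) (r ∘ suc)
tabulate-split (suc k) g r (suc t) with tabulate-split k (g ∘ suc) (r ∘ suc) t
... | ys , zs , e , c₁ , c₂ = g zero ∷ ys , zs , cong (g zero ∷_) e , r zero ∷ c₁ , c₂

unique-rotate : (ys zs : List (Fin n)) → Unique (ys ++ zs) → Unique (zs ++ ys)
unique-rotate ys zs = Perm.Unique-resp-↭ (Perm.++-comm ys zs)
  where
  import Data.List.Relation.Binary.Permutation.Setoid.Properties (setoid (Fin _)) as Perm

length-rotate : (ys zs : List (Fin n)) → length (ys ++ zs) ≡ length (zs ++ ys)
length-rotate ys zs = trans (length-++ ys) (trans (ℕ.+-comm (length ys) _) (sym (length-++ zs)))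

-- A cycle through e, cut open at e: the path joins the two ends of e.
record CycleAt (R : Fin n → Fin n → Set) (e : Edge n) : Set where
  constructor cycleAt
  field
    {a b}   : Fin n
    {verts} : List (Fin n)
    ends    : norm a b ≡ e
    path    : Chain R a verts b
    distinct : Unique verts
    long    : 3 ≤ length verts

-- Removing an inner step leaves two arcs. They are rejoined through `wrap`, so the vertices appear
-- rotated and the path runs from the end of the step back to its start.
step⇒cycleAt : {B : Fin n → Fin n → Bool} (C : Cycle B) → ∀ {u v} → Step C u v →
               Σ (CycleAt (CycleEdge C) (norm u v)) λ Z → length (CycleAt.verts Z) ≡ len C
step⇒cycleAt C wrap = cycleAt (norm-comm _ _) (tabulate-chain (k C) (vs C) (λ i → inj₁ (mid i))) un l , length-tabulate (vs C)
  where
  un = Unique.tabulate⁺ (inj C)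
  l = subst (3 ≤_) (sym (length-tabulate (vs C))) (s≤s (k≥2 C))
step⇒cycleAt C (mid i) with tabulate-split (k C) (vs C) (λ i → inj₁ (mid i)) i
... | ys , zs , e , c₁ , c₂ =
  cycleAt (norm-comm _ _) (chain-++ c₂ (inj₁ wrap) c₁)
    (unique-rotate ys zs (subst Unique e (Unique.tabulate⁺ (inj C))))
    (subst (3 ≤_) (sym len≡) (s≤s (k≥2 C))) , len≡
  where
  len≡ : length (zs ++ ys) ≡ len C
  len≡ = trans (length-rotate zs ys) (trans (cong length (sym e)) (length-tabulate (vs C)))

cycleEdge⇒cycleAt : {B : Fin n → Fin n → Bool} (C : Cycle B) → ∀ {u v} → CycleEdge C u v →
                    Σ (CycleAt (CycleEdge C) (norm u v)) λ Z → length (CycleAt.verts Z) ≡ len C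
cycleEdge⇒cycleAt C (inj₁ s)         = step⇒cycleAt C s
cycleEdge⇒cycleAt C {u} {v} (inj₂ s) =
  subst (λ e → Σ (CycleAt (CycleEdge C) e) λ Z → length (CycleAt.verts Z) ≡ len C) (norm-comm v u) (step⇒cycleAt C s)

-- Gauges on spanning forests

Joined : List (Edge n) → Fin n → Fin n → Set
Joined A a b = norm a b ∈ A

Joined-sym : (A : List (Edge n)) → ∀ {a b} → Joined A a b → Joined A b a
Joined-sym A {a} {b} = subst (_∈ A) (norm-comm a b)

-- A cover whose matchings are perfect; only the values at ordered edges matter.
Transport : ℕ → ℕ → Set
Transport n m = Edge n → Permutation′ m

ι : Transport n m
ι _ = id

-- Agreement is a conflict: the cover vertices that `f` picks over the two ends of `e` are joined.
-- Colourings avoid it on every edge.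
Agree : Transport n m → Vec (Fin m) n → Edge n → Set
Agree σ f e = σ e ⟨$⟩ʳ lookup f (proj₁ e) ≡ lookup f (proj₂ e)

agree? : (σ : Transport n m) (f : Vec (Fin m) n) (e : Edge n) → Dec (Agree σ f e)
agree? σ f e = (σ e ⟨$⟩ʳ lookup f (proj₁ e)) ≟ lookup f (proj₂ e)

N : Transport n m → List (Edge n) → ℕ
N {n} {m} σ A = ∑ (vecs (allFin m) n) (λ f → 𝟙 (all? (agree? σ f) A))

infix 4 _∈ᵉ?_
_∈ᵉ?_ : (e : Edge n) (A : List (Edge n)) → Dec (e ∈ A)
e ∈ᵉ? A = any? (≡-dec _≟_ _≟_ e) A

-- The labels name the components of A, and π is a gauge in which σ is trivial on the forest F.
record Forest (σ : Transport n m) (A : List (Edge n)) : Set where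
  field
    F       : List (Edge n)
    F⊆A     : ∀ {e} → e ∈ F → e ∈ A
    label   : Fin n → Fin n
    label-F : ∀ {e} → e ∈ F → label (proj₁ e) ≡ label (proj₂ e)
    path    : ∀ u v → label u ≡ label v → ∃ λ xs → Chain (Joined F) u xs v × Unique xs
    π       : Fin n → Permutation′ m
    gauge   : ∀ {e} → e ∈ F → ∀ x → σ e ⟨$⟩ʳ (π (proj₁ e) ⟨$⟩ʳ x) ≡ π (proj₂ e) ⟨$⟩ʳ x
    label-A : ∀ {e} → e ∈ A → label (proj₁ e) ≡ label (proj₂ e)

module Insert (σ : Transport n m) {A : List (Edge n)} (Φ : Forest σ A) {u v : Fin n} (u<v : Ordered (u , v)) where
  open Forest Φ

  label-chain : ∀ {x xs y} → Chain (Joined F) x xs y → ∀ {w} → w ∈ xs → label w ≡ label x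
  label-chain c = edges-constant label c (λ i → label-F (edges-all (λ r → r) c i))

  skip : label u ≡ label v → Forest σ ((u , v) ∷ A)
  skip eq = record
    { F = F ; F⊆A = there ∘ F⊆A ; label = label ; label-F = label-F ; path = path ; π = π ; gauge = gauge
    ; label-A = λ { (here refl) → eq ; (there i) → label-A i } }

  module Join (lu≢lv : label u ≢ label v) where
    e : Edge n
    e = u , v

    label′ : Fin n → Fin n
    label′ w with label w ≟ label v
    ... | yes _ = label u
    ... | no  _ = label w

    -- A gauge may be changed by one common permutation on a whole component. On that of `v` this
    -- one is forced: `π v` after `correction` is `σ e` after `π u`, which makes the new edge
    -- trivial.
    correction : Permutation′ m
    correction = π u ∘ₚ σ e ∘ₚ flip (π v)

    π′ : Fin n → Permutation′ m
    π′ w with label w ≟ label v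
    ... | yes _ = correction ∘ₚ π w
    ... | no  _ = π w

    uv : Joined (e ∷ F) u v
    uv = here (norm-ordered u<v)

    label′-cong : ∀ {a b} → label a ≡ label b → label′ a ≡ label′ b
    label′-cong {a} {b} eq with label a ≟ label v | label b ≟ label v
    ... | yes _ | yes _ = refl
    ... | yes p | no q  = contradiction (trans (sym eq) p) q
    ... | no p  | yes q = contradiction (trans eq q) p
    ... | no _  | no _  = eq

    label′-uv : label′ u ≡ label′ v
    label′-uv with label u ≟ label v | label v ≟ label v
    ... | yes p | _     = contradiction p lu≢lv
    ... | no _  | yes _ = refl
    ... | no _  | no q  = contradiction refl q

    grow : ∀ {x xs y} → Chain (Joined F) x xs y → Chain (Joined (e ∷ F)) x xs y
    grow = chain-map there

    -- Labels are constant along each path, so paths in components with different labels share no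
    -- vertex.
    bridge : ∀ {x xs y z ys w} → Chain (Joined F) x xs y → Joined (e ∷ F) y z → Chain (Joined F) z ys w →
             Unique xs → Unique ys → label x ≢ label z →
             ∃ λ zs → Chain (Joined (e ∷ F)) x zs w × Unique zs
    bridge c r d u u′ ne = _ , chain-++ (grow c) r (grow d) ,
      Unique.++⁺ u u′ (λ { (i , j) → ne (trans (sym (label-chain c i)) (label-chain d j)) })

    path′ : ∀ a b → label′ a ≡ label′ b → ∃ λ xs → Chain (Joined (e ∷ F)) a xs b × Unique xs
    path′ a b eq with label a ≟ label v | label b ≟ label v
    ... | yes p | yes q = let xs , c , un = path a b (trans p (sym q)) in xs , grow c , un
    ... | no p  | no q  = let xs , c , un = path a b eq in xs , grow c , un
    ... | yes p | no q  =
      let xs , c , un = path a v p ; ys , d , un′ = path u b eq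
      in bridge c (Joined-sym (e ∷ F) uv) d un un′ (λ h → lu≢lv (trans (sym h) p))
    ... | no p  | yes q =
      let xs , c , un = path a u eq ; ys , d , un′ = path v b (sym q)
      in bridge c uv d un un′ p

    gauge-old : ∀ {f} → f ∈ F → ∀ x → σ f ⟨$⟩ʳ (π′ (proj₁ f) ⟨$⟩ʳ x) ≡ π′ (proj₂ f) ⟨$⟩ʳ x
    gauge-old {a , b} i x with label a ≟ label v | label b ≟ label v
    ... | yes p | yes q = gauge i (correction ⟨$⟩ʳ x)
    ... | yes p | no q  = contradiction (trans (sym (label-F i)) p) q
    ... | no p  | yes q = contradiction (trans (label-F i) q) p
    ... | no _  | no _  = gauge i x

    gauge-new : ∀ x → σ e ⟨$⟩ʳ (π′ u ⟨$⟩ʳ x) ≡ π′ v ⟨$⟩ʳ x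
    gauge-new x with label u ≟ label v | label v ≟ label v
    ... | yes p | _     = contradiction p lu≢lv
    ... | no _  | yes _ = sym (inverseʳ (π v))
    ... | no _  | no q  = contradiction refl q

    join : Forest σ (e ∷ A)
    join = record
      { F = e ∷ F
      ; F⊆A = λ { (here p) → here p ; (there i) → there (F⊆A i) }
      ; label = label′
      ; label-F = λ { (here refl) → label′-uv ; (there i) → label′-cong (label-F i) }
      ; path = path′
      ; π = π′
      ; gauge = λ { (here refl) → gauge-new ; (there i) → gauge-old i }
      ; label-A = λ { (here refl) → label′-uv ; (there i) → label′-cong (label-A i) }
      }

-- As in Kruskal's algorithm, an edge between two components joins them, and an edge inside one
-- component is left out of `F`.
forest : (σ : Transport n m) (A : List (Edge n)) → All Ordered A → Forest σ A
forest σ []      _ = record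
  { F = [] ; F⊆A = λ () ; label = λ v → v ; label-F = λ ()
  ; path = λ { u .u refl → u ∷ [] , [ u ] , [] ∷ [] }
  ; π = ι′ ; gauge = λ () ; label-A = λ () }
  where
  ι′ : Fin _ → Permutation′ _
  ι′ _ = id
forest σ ((u , v) ∷ A) (u<v ∷ ord) = decide (forest σ A ord)
  where
  decide : Forest σ A → Forest σ ((u , v) ∷ A)
  decide Φ with Forest.label Φ u ≟ Forest.label Φ v
  ... | yes p = Insert.skip σ Φ u<v p
  ... | no ¬p = Insert.Join.join σ Φ u<v ¬p

all-agree-perm : (τ : Permutation′ m) (A : List (Edge n)) (f : Vec (Fin m) n) →
                 𝟙 (all? (agree? ι (act (λ _ → τ) f)) A) ≡ 𝟙 (all? (agree? ι f) A)
all-agree-perm τ A f = 𝟙-cong (all? _ A) (all? _ A) (All.map from) (All.map to)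
  where
  to : ∀ {e} → Agree ι f e → Agree ι (act (λ _ → τ) f) e
  to {u , v} a rewrite lookup∘tabulate (λ w → τ ⟨$⟩ʳ lookup f w) u | lookup∘tabulate (λ w → τ ⟨$⟩ʳ lookup f w) v =
    cong (τ ⟨$⟩ʳ_) a
  from : ∀ {e} → Agree ι (act (λ _ → τ) f) e → Agree ι f e
  from {u , v} a rewrite lookup∘tabulate (λ w → τ ⟨$⟩ʳ lookup f w) u | lookup∘tabulate (λ w → τ ⟨$⟩ʳ lookup f w) v =
    trans (sym (inverseˡ τ)) (trans (cong (τ ⟨$⟩ˡ_) a) (inverseˡ τ))

transpose-here : (x y : Fin m) → transpose x y ⟨$⟩ʳ x ≡ y
transpose-here x y with x ≟ x
... | yes _ = refl
... | no ¬p = contradiction refl ¬p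

-- One permutation of the colours applied at all vertices preserves agreement under `ι`, so all
-- values at `v` are equally frequent. The weight `s` will be the indicator of the points that an
-- edge moves or fixes.
uniform : (A : List (Edge n)) (v : Fin n) (s : Fin m → ℕ) →
          m * ∑ (vecs (allFin m) n) (λ f → 𝟙 (all? (agree? ι f) A) * s (lookup f v))
          ≡ ∑ (allFin m) s * N ι A
uniform {n} {m} A v s = begin
  m * ∑ V (λ f → c f * s (lookup f v))
    ≡⟨ cong (m *_) (∑-cong V (λ f → trans (cong (c f *_) (sym (∑-δ m (lookup f v) s)))
         (trans (sym (∑-* (c f) M _)) (∑-cong M (λ x → shuffle (c f) _ (s x)))))) ⟩
  m * ∑ V (λ f → ∑ M (λ x → s x * (c f * 𝟙 (x ≟ lookup f v))))
    ≡⟨ cong (m *_) (trans (∑-swap V M _) (∑-cong M (λ x → ∑-* (s x) V _))) ⟩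
  m * ∑ M (λ x → s x * hits x)
    ≡⟨ ∑-* m M _ ⟨
  ∑ M (λ x → m * (s x * hits x))
    ≡⟨ ∑-cong M (λ x → trans (trans (ℕ.*-comm m _) (ℕ.*-assoc (s x) (hits x) m))
                      (trans (cong (s x *_) (trans (ℕ.*-comm (hits x) m) (m*hits x))) (ℕ.*-comm (s x) (N ι A)))) ⟩
  ∑ M (λ x → N ι A * s x)
    ≡⟨ trans (∑-* (N ι A) M s) (ℕ.*-comm (N ι A) _) ⟩
  ∑ M s * N ι A ∎
  where
  open ≡-Reasoning
  V = vecs (allFin m) n
  M = allFin m
  c : Vec (Fin m) n → ℕ
  c f = 𝟙 (all? (agree? ι f) A)
  hits : Fin m → ℕ
  hits x = ∑ V (λ f → c f * 𝟙 (x ≟ lookup f v))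
  shuffle : ∀ a b d → a * (b * d) ≡ d * (a * b)
  shuffle a b d = trans (sym (ℕ.*-assoc a b d)) (ℕ.*-comm (a * b) d)
  hits-const : ∀ x y → hits x ≡ hits y
  hits-const x y = trans (sym (∑-act (λ _ → transpose y x) (λ f → c f * 𝟙 (x ≟ lookup f v)))) (∑-cong V (λ f → cong₂ _*_
    (all-agree-perm (transpose y x) A f)
    (𝟙-cong (x ≟ _) (y ≟ lookup f v) (to f) (from f))))
    where
    τ = transpose y x
    to : ∀ f → x ≡ lookup (act (λ _ → τ) f) v → y ≡ lookup f v
    to f e = trans (sym (inverseˡ τ)) (trans (cong (τ ⟨$⟩ˡ_) (trans (transpose-here y x)
      (trans e (lookup∘tabulate (λ w → τ ⟨$⟩ʳ lookup f w) v)))) (inverseˡ τ))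
    from : ∀ f → y ≡ lookup f v → x ≡ lookup (act (λ _ → τ) f) v
    from f e = trans (sym (transpose-here y x)) (trans (cong (τ ⟨$⟩ʳ_) e) (sym (lookup∘tabulate (λ w → τ ⟨$⟩ʳ lookup f w) v)))
  m*hits : ∀ x → m * hits x ≡ N ι A
  m*hits x = begin
    m * hits x               ≡⟨ cong (_* hits x) (length-allFin m) ⟨
    length M * hits x        ≡⟨ ∑-const M (hits x) ⟨
    ∑ M (λ _ → hits x)       ≡⟨ ∑-cong M (hits-const x) ⟩
    ∑ M hits                 ≡⟨ ∑-swap M V _ ⟩
    ∑ V (λ f → ∑ M (λ y → c f * 𝟙 (y ≟ lookup f v)))
      ≡⟨ ∑-cong V (λ f → trans (∑-cong M (λ y → ℕ.*-comm (c f) _)) (∑-δ m (lookup f v) (λ _ → c f))) ⟩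
    N ι A                 ∎

module _ {σ : Transport n m} {A : List (Edge n)} (Φ : Forest σ A) where
  open Forest Φ

  -- Under `ι`, agreement on `F` makes a function constant on each component, and by `label-A` every
  -- edge of `A` stays within one.
  N-ι-forest : N ι F ≡ N ι A
  N-ι-forest = ∑-cong (vecs (allFin m) n) (λ f → 𝟙-cong (all? _ F) (all? _ A)
    (λ k → All.tabulate (λ {e} i → const f k e (label-A i)))
    (λ k → All.tabulate (λ i → All.lookup k (F⊆A i))))
    where
    const : ∀ f → All (Agree ι f) F → ∀ e → label (proj₁ e) ≡ label (proj₂ e) → Agree ι f e
    const f k (u , v) eq = let xs , c , _ = path u v eq in
      sym (edges-constant (lookup f) c (λ i → All.lookup k (edges-all (λ r → r) c i)) (chain-last c))

  agree-gauge : (f : Vec (Fin m) n) → 𝟙 (all? (agree? σ (act π f)) F) ≡ 𝟙 (all? (agree? ι f) F)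
  agree-gauge f = 𝟙-cong (all? _ F) (all? _ F)
    (λ k → All.tabulate (λ i → from i (All.lookup k i))) (λ k → All.tabulate (λ i → to i (All.lookup k i)))
    where
    to : ∀ {e} → e ∈ F → Agree ι f e → Agree σ (act π f) e
    to {u , w} i a
      rewrite lookup∘tabulate (λ w → π w ⟨$⟩ʳ lookup f w) u | lookup∘tabulate (λ w → π w ⟨$⟩ʳ lookup f w) w =
      trans (gauge i (lookup f u)) (cong (π w ⟨$⟩ʳ_) a)
    from : ∀ {e} → e ∈ F → Agree σ (act π f) e → Agree ι f e
    from {u , w} i a
      rewrite lookup∘tabulate (λ w → π w ⟨$⟩ʳ lookup f w) u | lookup∘tabulate (λ w → π w ⟨$⟩ʳ lookup f w) w =
      trans (sym (inverseˡ (π w))) (trans (cong (π w ⟨$⟩ˡ_) (trans (sym (gauge i (lookup f u))) a)) (inverseˡ (π w)))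

  -- A forest carries no twist: the gauge turns `σ` into `ι` on `F`. Any deficit is therefore due to
  -- the edges of `A` outside `F`.
  N-forest : N σ F ≡ N ι A
  N-forest = trans (sym (∑-act π _)) (trans (∑-cong (vecs (allFin m) n) agree-gauge) N-ι-forest)

  uniform-forest : (v : Fin n) (s : Fin m → ℕ) →
    m * ∑ (vecs (allFin m) n) (λ f → 𝟙 (all? (agree? σ f) F) * s (lookup f v)) ≡ ∑ (allFin m) s * N ι A
  uniform-forest v s = begin
    m * ∑ V (λ f → 𝟙 (all? (agree? σ f) F) * s (lookup f v))
      ≡⟨ cong (m *_) (∑-act π _) ⟨
    m * ∑ V (λ f → 𝟙 (all? (agree? σ (act π f)) F) * s (lookup (act π f) v))
      ≡⟨ cong (m *_) (∑-cong V (λ f → cong₂ _*_ (agree-gauge f)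
           (cong s (lookup∘tabulate (λ w → π w ⟨$⟩ʳ lookup f w) v)))) ⟩
    m * ∑ V (λ f → 𝟙 (all? (agree? ι f) F) * s (π v ⟨$⟩ʳ lookup f v))
      ≡⟨ uniform F v (λ x → s (π v ⟨$⟩ʳ x)) ⟩
    ∑ (allFin m) (λ x → s (π v ⟨$⟩ʳ x)) * N ι F
      ≡⟨ cong₂ _*_ (∑-perm (π v) s) N-ι-forest ⟩
    ∑ (allFin m) s * N ι A ∎
    where
    open ≡-Reasoning
    V = vecs (allFin m) n

-- Bounds for N ι A and for the deficit N ι A ∸ N σ A

Fixed Moved : Transport n m → Edge n → Fin m → Set
Fixed σ e x = σ e ⟨$⟩ʳ x ≡ x
Moved σ e x = ¬ Fixed σ e x

fixed? : (σ : Transport n m) (e : Edge n) (x : Fin m) → Dec (Fixed σ e x)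
fixed? σ e x = (σ e ⟨$⟩ʳ x) ≟ x

moved? : (σ : Transport n m) (e : Edge n) (x : Fin m) → Dec (Moved σ e x)
moved? σ e x = ¬? (fixed? σ e x)

twist : Transport n m → Edge n → ℕ
twist {m = m} σ e = ∑ (allFin m) (λ x → 𝟙 (moved? σ e x))

fixed+twist : (σ : Transport n m) (e : Edge n) → ∑ (allFin m) (λ x → 𝟙 (fixed? σ e x)) + twist σ e ≡ m
fixed+twist {m = m} σ e = trans (sym (∑-+ (allFin m) _ _))
  (trans (∑-cong (allFin m) (λ x → 𝟙-¬ (fixed? σ e x)))
  (trans (∑-const (allFin m) 1) (trans (ℕ.*-identityʳ _) (length-allFin m))))

unmoved-path : (σ : Transport n m) (f : Vec (Fin m) n) → ∀ {R x xs y} (c : Chain R x xs y) →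
               (∀ {e} → e ∈ edges c → Agree σ f e) → (∀ {e} → e ∈ edges c → Fixed σ e (lookup f (proj₁ e))) →
               lookup f x ≡ lookup f y
unmoved-path σ f c agree fixed =
  sym (edges-constant (lookup f) c (λ i → trans (sym (fixed i)) (agree i)) (chain-last c))

not-any-moved : (σ : Transport n m) (f : Vec (Fin m) n) {L : List (Edge n)} →
                ¬ Any (λ e → Moved σ e (lookup f (proj₁ e))) L → ∀ {e} → e ∈ L → Fixed σ e (lookup f (proj₁ e))
not-any-moved σ f none {e} i =
  decidable-stable (fixed? σ e _) (All.lookup (¬Any⇒All¬ _ none) i)

module _ {σ : Transport n m} {A : List (Edge n)} (Φ : Forest σ A) where
  open Forest Φ

  private
    V = vecs (allFin m) n

  -- A function consistent with the forest takes a given value at a given vertex with frequency 1 / m, so it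
  -- is moved by e with frequency twist σ e / m.
  union-bound : {P : Vec (Fin m) n → Set} (p? : ∀ f → Dec (P f)) (L : List (Edge n)) →
    (∀ f → P f → All (Agree σ f) F → Any (λ e → Moved σ e (lookup f (proj₁ e))) L) →
    m * ∑ V (λ f → 𝟙 (all? (agree? σ f) F ×-dec p? f)) ≤ ∑ L (λ e → twist σ e * N {m = m} ι A)
  union-bound p? L jump = begin
    m * ∑ V (λ f → 𝟙 (all? (agree? σ f) F ×-dec p? f))
      ≤⟨ ℕ.*-monoʳ-≤ m (∑-mono V (λ {f} _ → 𝟙-any (all? (agree? σ f) F ×-dec p? f)
           (λ e → all? (agree? σ f) F ×-dec moved? σ e (lookup f (proj₁ e))) L
           (λ { (k , q) → Any.map (k ,_) (jump f q k) }))) ⟩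
    m * ∑ V (λ f → ∑ L (λ e → 𝟙 (all? (agree? σ f) F ×-dec moved? σ e (lookup f (proj₁ e)))))
      ≡⟨ cong (m *_) (trans (∑-cong V (λ f → ∑-cong L (λ e → 𝟙-× (all? (agree? σ f) F) _))) (∑-swap V L _)) ⟩
    m * ∑ L (λ e → ∑ V (λ f → 𝟙 (all? (agree? σ f) F) * 𝟙 (moved? σ e (lookup f (proj₁ e)))))
      ≡⟨ ∑-* m L _ ⟨
    ∑ L (λ e → m * ∑ V (λ f → 𝟙 (all? (agree? σ f) F) * 𝟙 (moved? σ e (lookup f (proj₁ e)))))
      ≡⟨ ∑-cong L (λ e → uniform-forest Φ (proj₁ e) (λ x → 𝟙 (moved? σ e x))) ⟩
    ∑ L (λ e → twist σ e * N {m = m} ι A) ∎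
    where open ℕ.≤-Reasoning

  N-≤ : N σ A ≤ N {m = m} ι A
  N-≤ = subst (N σ A ≤_) (N-forest Φ)
    (∑-mono V (λ {f} _ → 𝟙-mono (all? (agree? σ f) A) (all? (agree? σ f) F)
      (λ k → All.tabulate (λ i → All.lookup k (F⊆A i)))))

  chain-agree : ∀ f {x xs y} (c : Chain (Joined F) x xs y) → All (Agree σ f) F →
                ∀ {e} → e ∈ edges c → Agree σ f e
  chain-agree f c k i = All.lookup k (edges-all (λ r → r) c i)

  long-path : ∀ {u v xs} (c : Chain (Joined F) u xs v) → u Fin.< v → (u , v) ∉ F → 3 ≤ length xs
  long-path [ _ ]           lt _  = contradiction lt (Fin.<-irrefl refl)
  long-path (r ∷ [ _ ])     lt ∉F = contradiction (subst (_∈ F) (norm-ordered lt) r) ∉F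
  long-path (_ ∷ _ ∷ [ _ ]) _  _  = s≤s (s≤s (s≤s z≤n))
  long-path (_ ∷ _ ∷ _ ∷ _) _  _  = s≤s (s≤s (s≤s z≤n))

  -- The path of `F` between the ends of `g` closes with `g` to a cycle. If `f` agrees on the path
  -- but not on `g`, some edge of this cycle moves the value of `f` at its first end; otherwise `f`
  -- would be constant along the path and agree on `g`. The cycle has at most `n` edges, and `small`
  -- applies to each because the cycle can be cut open at any of them.
  edge-deficit : (B : ℕ) → (∀ {e} → e ∈ A → CycleAt (Joined A) e → N {m = m} ι A * twist σ e ≤ B) →
    ∀ {g} → Ordered g → g ∈ A → m * ∑ V (λ f → 𝟙 (all? (agree? σ f) F ×-dec ¬? (agree? σ f g))) ≤ n * B
  edge-deficit B small {g@(u , v)} u<v g∈A with g ∈ᵉ? F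
  ... | yes g∈F = begin
    m * ∑ V (λ f → 𝟙 (all? (agree? σ f) F ×-dec ¬? (agree? σ f g)))
      ≡⟨ cong (m *_) (trans (∑-cong V (λ f → 𝟙-no (all? (agree? σ f) F ×-dec ¬? (agree? σ f g))
           (λ { (k , ¬a) → ¬a (All.lookup k g∈F) }))) (∑-zero V)) ⟩
    m * 0 ≡⟨ ℕ.*-zeroʳ m ⟩
    0     ≤⟨ z≤n ⟩
    n * B ∎
    where open ℕ.≤-Reasoning
  ... | no g∉F with path u v (label-A g∈A)
  ...   | xs , c , un = begin
    m * ∑ V (λ f → 𝟙 (all? (agree? σ f) F ×-dec ¬? (agree? σ f g)))
      ≤⟨ union-bound (λ f → ¬? (agree? σ f g)) L jump ⟩
    ∑ L (λ e → twist σ e * N {m = m} ι A)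
      ≤⟨ ∑-bounded L (λ {e} i → subst (_≤ B) (ℕ.*-comm (N {m = m} ι A) (twist σ e)) (small (L⊆A i) (cyc i))) ⟩
    length L * B
      ≤⟨ ℕ.*-monoˡ-≤ B (subst (_≤ n) (length-edges c) (unique-length≤ un)) ⟩
    n * B ∎
    where
    open ℕ.≤-Reasoning
    L = g ∷ edges c
    long = long-path c u<v g∉F
    L⊆A : ∀ {e} → e ∈ L → e ∈ A
    L⊆A (here refl) = g∈A
    L⊆A (there i)   = F⊆A (edges-all (λ r → r) c i)
    jump : (f : Vec (Fin m) n) → ¬ Agree σ f g → All (Agree σ f) F → Any (λ e → Moved σ e (lookup f (proj₁ e))) L
    jump f ¬a k = decidable-stable (any? (λ e → moved? σ e (lookup f (proj₁ e))) L) (λ none →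
      ¬a (trans (not-any-moved σ f none (here refl))
                (unmoved-path σ f c (chain-agree f c k) (not-any-moved σ f none ∘ there))))
    cyc : ∀ {e} → e ∈ L → CycleAt (Joined A) e
    cyc (here refl) = cycleAt (norm-ordered u<v) (chain-map F⊆A c) un long
    cyc (there i) with edges-split c i
    ... | a , b , ys , zs , refl , refl , c₁ , c₂ =
      cycleAt (norm-comm b a)
        (chain-++ (chain-map F⊆A c₂) (subst (_∈ A) (sym (trans (norm-comm v u) (norm-ordered u<v))) g∈A) (chain-map F⊆A c₁))
        (unique-rotate ys zs un) (subst (3 ≤_) (length-rotate ys zs) long)

  -- `N ι A` equals `N σ F`, and a function counted there but not in `N σ A` fails to agree on some
  -- edge `g` of `A`. Summing `edge-deficit` over `g` bounds all failures.
  deficit-upper : All Ordered A → (B : ℕ) →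
    (∀ {e} → e ∈ A → CycleAt (Joined A) e → N {m = m} ι A * twist σ e ≤ B) →
    m * N {m = m} ι A ≤ m * N σ A + length A * (n * B)
  deficit-upper ord B small = begin
    m * N {m = m} ι A
      ≡⟨ cong (m *_) (N-forest Φ) ⟨
    m * N σ F
      ≤⟨ ℕ.*-monoʳ-≤ m (∑-mono V (λ {f} _ → split f)) ⟩
    m * ∑ V (λ f → 𝟙 (all? (agree? σ f) A) + ∑ A (λ g → bad f g))
      ≡⟨ trans (cong (m *_) (∑-+ V _ _)) (ℕ.*-distribˡ-+ m (N σ A) _) ⟩
    m * N σ A + m * ∑ V (λ f → ∑ A (λ g → bad f g))
      ≡⟨ cong (m * N σ A +_) (trans (cong (m *_) (∑-swap V A bad)) (sym (∑-* m A _))) ⟩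
    m * N σ A + ∑ A (λ g → m * ∑ V (λ f → bad f g))
      ≤⟨ ℕ.+-monoʳ-≤ (m * N σ A) (∑-bounded A (λ i → edge-deficit B small (All.lookup ord i) i)) ⟩
    m * N σ A + length A * (n * B) ∎
    where
    open ℕ.≤-Reasoning
    bad : Vec (Fin m) n → Edge n → ℕ
    bad f g = 𝟙 (all? (agree? σ f) F ×-dec ¬? (agree? σ f g))
    split : ∀ f → 𝟙 (all? (agree? σ f) F) ≤ 𝟙 (all? (agree? σ f) A) + ∑ A (bad f)
    split f with all? (agree? σ f) A
    ... | yes _ = ℕ.≤-trans (𝟙≤1 (all? (agree? σ f) F)) (ℕ.m≤m+n 1 _)
      where
      𝟙≤1 : ∀ {P : Set} (p : Dec P) → 𝟙 p ≤ 1
      𝟙≤1 (yes _) = ℕ.≤-refl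
      𝟙≤1 (no _)  = z≤n
    ... | no ¬k = 𝟙-any (all? (agree? σ f) F) (λ g → all? (agree? σ f) F ×-dec ¬? (agree? σ f g)) A
      (λ k → Any.map (k ,_) (¬All⇒Any¬ (agree? σ f) A ¬k))

  -- A function that agrees on `A` either meets a moved point on the path, or is constant along it
  -- and then has a value fixed by `σ e`. The union bound controls the first kind; fixed values have
  -- frequency `1 - twist σ e / m`, which produces the deficit.
  deficit-lower : ∀ {R e a b xs} → norm a b ≡ e → e ∈ A → (c : Chain R a xs b) →
    (∀ {g} → g ∈ edges c → g ∈ A) →
    m * N σ A + twist σ e * N {m = m} ι A ≤ m * N {m = m} ι A + ∑ (edges c) (λ g → twist σ g * N {m = m} ι A)
  deficit-lower {e = e} {a} {b} ends e∈A c edges⊆A = begin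
    m * N σ A + twist σ e * N {m = m} ι A
      ≤⟨ ℕ.+-monoˡ-≤ _ (ℕ.*-monoʳ-≤ m (∑-mono V (λ {f} _ →
           𝟙-⊎ (all? (agree? σ f) A)
             (all? (agree? σ f) F ×-dec fixed? σ e (lookup f (proj₁ e)))
             (all? (agree? σ f) F ×-dec jumps? f) (split f)))) ⟩
    m * ∑ V (λ f → 𝟙 (all? (agree? σ f) F ×-dec fixed? σ e (lookup f (proj₁ e))) + 𝟙 (all? (agree? σ f) F ×-dec jumps? f)) + twist σ e * N {m = m} ι A
      ≡⟨ cong (_+ twist σ e * N {m = m} ι A) (trans (cong (m *_) (∑-+ V _ _)) (ℕ.*-distribˡ-+ m _ _)) ⟩
    (m * ∑ V (λ f → 𝟙 (all? (agree? σ f) F ×-dec fixed? σ e (lookup f (proj₁ e)))) + m * ∑ V (λ f → 𝟙 (all? (agree? σ f) F ×-dec jumps? f))) + twist σ e * N {m = m} ι A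
      ≤⟨ ℕ.+-monoˡ-≤ (twist σ e * N {m = m} ι A) (ℕ.+-mono-≤
           (ℕ.≤-reflexive (trans (cong (m *_) (∑-cong V (λ f → 𝟙-× (all? (agree? σ f) F) _)))
             (uniform-forest Φ (proj₁ e) (λ x → 𝟙 (fixed? σ e x)))))
           (union-bound jumps? (edges c) (λ _ j _ → j))) ⟩
    (φ * N {m = m} ι A + S) + twist σ e * N {m = m} ι A
      ≡⟨ shuffle (φ * N {m = m} ι A) S _ ⟩
    (φ * N {m = m} ι A + twist σ e * N {m = m} ι A) + S
      ≡⟨ cong (_+ S) (trans (sym (ℕ.*-distribʳ-+ (N {m = m} ι A) φ (twist σ e))) (cong (_* N {m = m} ι A) (fixed+twist σ e))) ⟩
    m * N {m = m} ι A + S ∎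
    where
    open ℕ.≤-Reasoning
    φ S : ℕ
    φ = ∑ (allFin m) (λ x → 𝟙 (fixed? σ e x))
    S = ∑ (edges c) (λ g → twist σ g * N {m = m} ι A)
    shuffle : ∀ a b c → (a + b) + c ≡ (a + c) + b
    shuffle a b c = trans (ℕ.+-assoc a b c) (trans (cong (a +_) (ℕ.+-comm b c)) (sym (ℕ.+-assoc a c b)))
    jumps? : (f : Vec (Fin m) n) → Dec (Any (λ g → Moved σ g (lookup f (proj₁ g))) (edges c))
    jumps? f = any? (λ g → moved? σ g (lookup f (proj₁ g))) (edges c)
    split : (f : Vec (Fin m) n) → All (Agree σ f) A →
      (All (Agree σ f) F × Fixed σ e (lookup f (proj₁ e))) ⊎
      (All (Agree σ f) F × Any (λ g → Moved σ g (lookup f (proj₁ g))) (edges c))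
    split f k with jumps? f
    ... | yes j = inj₂ (All.tabulate (λ i → All.lookup k (F⊆A i)) , j)
    ... | no ¬j = inj₁ (All.tabulate (λ i → All.lookup k (F⊆A i)) ,
      trans (All.lookup k e∈A) (sym (subst (λ e → lookup f (proj₁ e) ≡ lookup f (proj₂ e)) ends
        (norm-intro (λ a b → lookup f a ≡ lookup f b) sym a b
          (unmoved-path σ f c (λ i → All.lookup k (edges⊆A i)) (not-any-moved σ f ¬j))))))

-- Powers of `m` in `N ι A`

ConstantOn : Fin n → List (Fin n) → Vec (Fin m) n → Set
ConstantOn u ws f = All (λ w → lookup f w ≡ lookup f u) ws

constantOn? : (u : Fin n) (ws : List (Fin n)) (f : Vec (Fin m) n) → Dec (ConstantOn u ws f)
constantOn? u ws f = all? (λ w → lookup f w ≟ lookup f u) ws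

constantOn-update : {u : Fin n} {ws : List (Fin n)} {p : Fin n} → p ∉ u ∷ ws → (f : Vec (Fin m) n) (x : Fin m) →
                    𝟙 (constantOn? u ws (f [ p ]≔ x)) ≡ 𝟙 (constantOn? u ws f)
constantOn-update {u = u} {ws} {p} p∉ f x = 𝟙-cong (constantOn? u ws (f [ p ]≔ x)) (constantOn? u ws f)
  (λ k → All.tabulate (λ i → trans (sym (same (there i))) (trans (All.lookup k i) (same (here refl)))))
  (λ k → All.tabulate (λ i → trans (same (there i)) (trans (All.lookup k i) (sym (same (here refl))))))
  where
  same : ∀ {w} → w ∈ u ∷ ws → lookup (f [ p ]≔ x) w ≡ lookup f w
  same {w} i = lookup∘update′ (λ { refl → p∉ i }) f x

count-constantOn : (m : ℕ) {u : Fin n} {ws : List (Fin n)} → Unique (u ∷ ws) →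
                   ∑ (vecs (allFin m) n) (λ f → 𝟙 (constantOn? u ws f)) * m ^ length ws ≡ m ^ n
count-constantOn {n = n} m {u} {[]} _ = begin
  ∑ V (λ f → 𝟙 (constantOn? u [] f)) * 1  ≡⟨ ℕ.*-identityʳ _ ⟩
  ∑ V (λ _ → 1)                          ≡⟨ trans (∑-const V 1) (ℕ.*-identityʳ _) ⟩
  length V                               ≡⟨ length-vecs m n ⟩
  m ^ n ∎
  where
  open ≡-Reasoning
  V = vecs (allFin m) n
count-constantOn {n = n} m {u} {w ∷ ws} ((u≢w ∷ u∉) ∷ (w∉ ∷ un)) = begin
  ∑ V (λ f → 𝟙 (constantOn? u (w ∷ ws) f)) * (m * m ^ length ws)
    ≡⟨ trans (sym (ℕ.*-assoc K m _)) (cong (_* m ^ length ws) (ℕ.*-comm K m)) ⟩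
  m * ∑ V (λ f → 𝟙 (constantOn? u (w ∷ ws) f)) * m ^ length ws
    ≡⟨ cong (λ t → m * t * m ^ length ws) (∑-cong V (λ f → 𝟙-all-∷ (λ w → lookup f w ≟ lookup f u) w ws)) ⟩
  m * ∑ V (λ f → 𝟙 (lookup f w ≟ lookup f u) * 𝟙 (constantOn? u ws f)) * m ^ length ws
    ≡⟨ cong (_* m ^ length ws) (determined w (λ f → 𝟙 (constantOn? u ws f)) (λ f → lookup f u)
         (constantOn-update w∉uws) (λ f x → lookup∘update′ u≢w f x)) ⟩
  ∑ V (λ f → 𝟙 (constantOn? u ws f)) * m ^ length ws
    ≡⟨ count-constantOn m (u∉ ∷ un) ⟩
  m ^ n ∎
  where
  open ≡-Reasoning
  V = vecs (allFin m) n
  K = ∑ V (λ f → 𝟙 (constantOn? u (w ∷ ws) f))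
  w∉uws : w ∉ u ∷ ws
  w∉uws (here e)  = u≢w (sym e)
  w∉uws (there i) = All¬⇒¬Any w∉ i

chain-constant : {A : List (Edge n)} (f : Vec (Fin m) n) → All (Agree ι f) A →
                 ∀ {x xs y} → Chain (Joined A) x xs y → ∀ {w} → w ∈ xs → lookup f w ≡ lookup f x
chain-constant f k c = edges-constant (lookup f) c (λ i → All.lookup k (edges-all (λ r → r) c i))

chain-cons : {R : Fin n → Fin n → Set} → ∀ {x xs y} → Chain R x xs y → ∃ λ ws → xs ≡ x ∷ ws
chain-cons [ _ ]   = _ , refl
chain-cons (_ ∷ _) = _ , refl

module _ (m : ℕ) {A : List (Edge n)} {x y : Fin n} {xs : List (Fin n)} (un : Unique xs) where
  private
    V = vecs (allFin m) n

    regroup : ∀ s t → s * (m * t) ≡ m * s * t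
    regroup s t = trans (sym (ℕ.*-assoc s m t)) (cong (_* t) (ℕ.*-comm s m))

  N-path : Chain (Joined A) x xs y → N {m = m} ι A * m ^ length xs ≤ m * m ^ n
  N-path c with chain-cons c
  ... | ws , refl = begin
    N ι A * (m * m ^ length ws)
      ≤⟨ ℕ.*-monoˡ-≤ (m * m ^ length ws) (∑-mono V (λ {f} _ → 𝟙-mono (all? (agree? ι f) A) (constantOn? x ws f)
           (λ k → All.tabulate (λ i → chain-constant f k c (there i))))) ⟩
    ∑ V (λ f → 𝟙 (constantOn? x ws f)) * (m * m ^ length ws)
      ≡⟨ trans (regroup (∑ V (λ f → 𝟙 (constantOn? x ws f))) (m ^ length ws)) (ℕ.*-assoc m _ (m ^ length ws)) ⟩
    m * (∑ V (λ f → 𝟙 (constantOn? x ws f)) * m ^ length ws)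
      ≡⟨ cong (m *_) (count-constantOn m un) ⟩
    m * m ^ n ∎
    where open ℕ.≤-Reasoning

  -- Constancy on the path does not involve `p`, so the edge to `q` determines one more coordinate
  -- and saves a factor `m`. It makes no difference whether `q` lies on the path.
  N-path-extra : Chain (Joined A) x xs y → ∀ {p q} → p ≢ q → p ∉ xs → Joined A p q →
                 N {m = m} ι A * m ^ length xs ≤ m ^ n
  N-path-extra c {p} {q} p≢q p∉ pq with chain-cons c
  ... | ws , refl = begin
    N ι A * (m * m ^ length ws)
      ≤⟨ ℕ.*-monoˡ-≤ (m * m ^ length ws) (∑-mono V (λ {f} _ → ℕ.≤-trans
           (𝟙-mono (all? (agree? ι f) A) (lookup f p ≟ lookup f q ×-dec constantOn? x ws f)
             (λ k → norm-elim (λ a b → lookup f a ≡ lookup f b) sym p q (All.lookup k pq) ,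
                    All.tabulate (λ i → chain-constant f k c (there i))))
           (ℕ.≤-reflexive (𝟙-× (lookup f p ≟ lookup f q) (constantOn? x ws f))))) ⟩
    ∑ V (λ f → 𝟙 (lookup f p ≟ lookup f q) * 𝟙 (constantOn? x ws f)) * (m * m ^ length ws)
      ≡⟨ regroup (∑ V (λ f → 𝟙 (lookup f p ≟ lookup f q) * 𝟙 (constantOn? x ws f))) (m ^ length ws) ⟩
    m * ∑ V (λ f → 𝟙 (lookup f p ≟ lookup f q) * 𝟙 (constantOn? x ws f)) * m ^ length ws
      ≡⟨ cong (_* m ^ length ws) (determined p (λ f → 𝟙 (constantOn? x ws f)) (λ f → lookup f q)
           (constantOn-update p∉) (λ f z → lookup∘update′ (p≢q ∘ sym) f z)) ⟩
    ∑ V (λ f → 𝟙 (constantOn? x ws f)) * m ^ length ws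
      ≡⟨ count-constantOn m un ⟩
    m ^ n ∎
    where open ℕ.≤-Reasoning

module _ (m : ℕ) {A : List (Edge n)} {x : Fin n} {ws : List (Fin n)} where
  private
    V = vecs (allFin m) n

  N-within : Unique (x ∷ ws) → (∀ {e} → e ∈ A → proj₁ e ∈ x ∷ ws × proj₂ e ∈ x ∷ ws) →
             m * m ^ n ≤ N {m = m} ι A * m ^ length (x ∷ ws)
  N-within un inside = begin
    m * m ^ n
      ≡⟨ cong (m *_) (count-constantOn m un) ⟨
    m * (∑ V (λ f → 𝟙 (constantOn? x ws f)) * m ^ length ws)
      ≡⟨ trans (sym (ℕ.*-assoc m K _)) (trans (cong (_* m ^ length ws) (ℕ.*-comm m K)) (ℕ.*-assoc K m _)) ⟩
    K * (m * m ^ length ws)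
      ≤⟨ ℕ.*-monoˡ-≤ (m * m ^ length ws) (∑-mono V (λ {f} _ →
           𝟙-mono (constantOn? x ws f) (all? (agree? ι f) A) (λ k → All.tabulate (λ i →
             let p , q = inside i in trans (value f k p) (sym (value f k q)))))) ⟩
    N ι A * (m * m ^ length ws) ∎
    where
    open ℕ.≤-Reasoning
    K = ∑ V (λ f → 𝟙 (constantOn? x ws f))
    value : ∀ f → ConstantOn x ws f → ∀ {w} → w ∈ x ∷ ws → lookup f w ≡ lookup f x
    value f k (here refl) = refl
    value f k (there i)   = All.lookup k i

-- Twisted covers of DP-good graphs

edge? : (G : Graph n) (e : Edge n) → Dec (Ordered e × adj G (proj₁ e) (proj₂ e) ≡ true)
edge? G (u , v) = (u Fin.<? v) ×-dec (adj G u v Bool.≟ true)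

edgeList : Graph n → List (Edge n)
edgeList {n} G = filter (edge? G) (cartesianProduct (allFin n) (allFin n))

module _ (G : Graph n) where

  edgeList-sound : ∀ {e} → e ∈ edgeList G → Ordered e × adj G (proj₁ e) (proj₂ e) ≡ true
  edgeList-sound = proj₂ ∘ ∈-filter⁻ (edge? G) {xs = cartesianProduct (allFin n) (allFin n)}

  edgeList-complete : ∀ {e} → Ordered e → adj G (proj₁ e) (proj₂ e) ≡ true → e ∈ edgeList G
  edgeList-complete {u , v} u<v uv = ∈-filter⁺ (edge? G) (∈-cartesianProduct⁺ (∈-allFin u) (∈-allFin v)) (u<v , uv)

  edgeList-unique : Unique (edgeList G)
  edgeList-unique = Unique.filter⁺ (edge? G) (Unique.cartesianProduct⁺ (Unique.allFin⁺ n) (Unique.allFin⁺ n))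

  adj-sym : ∀ {a b} → adj G a b ≡ true → adj G b a ≡ true
  adj-sym {a} {b} = trans (symm G b a)

  adj-distinct : ∀ {a b} → adj G a b ≡ true → a ≢ b
  adj-distinct {a} ab refl with trans (sym ab) (irrefl G a)
  ... | ()

  norm∈edgeList : ∀ {a b} → adj G a b ≡ true → norm a b ∈ edgeList G
  norm∈edgeList {a} {b} ab = edgeList-complete (norm-orders (adj-distinct ab))
    (norm-intro (λ a b → adj G a b ≡ true) adj-sym a b ab)

  joined⇒adj : ∀ {a b} → Joined (edgeList G) a b → adj G a b ≡ true
  joined⇒adj {a} {b} i = norm-elim (λ a b → adj G a b ≡ true) adj-sym a b (proj₂ (edgeList-sound i))

-- For σ = ι these are the proper colourings.
colourings : Graph n → Transport n m → ℕ
colourings {n} {m} G σ = ∑ (vecs (allFin m) n) (λ f → 𝟙 (all? (λ e → ¬? (agree? σ f e)) (edgeList G)))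

colourings-expansion : (G : Graph n) (σ : Transport n m) →
  colourings G σ + ∑ (subs true (edgeList G)) (N σ) ≡ ∑ (subs false (edgeList G)) (N σ)
colourings-expansion {n} {m} G σ = begin
  colourings G σ + ∑ (subs true E) (N σ)
    ≡⟨ cong (colourings G σ +_) (∑-swap (subs true E) V _) ⟩
  colourings G σ + ∑ V (λ f → ∑ (subs true E) (λ S → 𝟙 (all? (agree? σ f) S)))
    ≡⟨ ∑-+ V _ _ ⟨
  ∑ V (λ f → 𝟙 (all? (λ e → ¬? (agree? σ f e)) E) + ∑ (subs true E) (λ S → 𝟙 (all? (agree? σ f) S)))
    ≡⟨ ∑-cong V (λ f → inclusion-exclusion (agree? σ f) E) ⟩
  ∑ V (λ f → ∑ (subs false E) (λ S → 𝟙 (all? (agree? σ f) S)))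
    ≡⟨ ∑-swap V (subs false E) _ ⟩
  ∑ (subs false E) (N σ) ∎
  where
  open ≡-Reasoning
  E = edgeList G
  V = vecs (allFin m) n

∑-gap : {A : Set} {xs : List A} {h g : A → ℕ} {y : A} {δ : ℕ} → (∀ {x} → x ∈ xs → h x ≤ g x) →
        y ∈ xs → h y + δ ≤ g y → ∑ xs h + δ ≤ ∑ xs g
∑-gap {xs = x ∷ xs} {h} {δ = δ} le (here refl) gap = begin
  h x + ∑ xs h + δ   ≡⟨ trans (ℕ.+-assoc (h x) _ δ) (trans (cong (h x +_) (ℕ.+-comm _ δ)) (sym (ℕ.+-assoc (h x) δ _))) ⟩
  (h x + δ) + ∑ xs h ≤⟨ ℕ.+-mono-≤ gap (∑-mono xs (le ∘ there)) ⟩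
  _                  ∎
  where open ℕ.≤-Reasoning
∑-gap {xs = x ∷ xs} {h} {δ = δ} le (there i) gap = begin
  h x + ∑ xs h + δ   ≡⟨ ℕ.+-assoc (h x) _ δ ⟩
  h x + (∑ xs h + δ) ≤⟨ ℕ.+-mono-≤ (le (here refl)) (∑-gap (le ∘ there) i gap) ⟩
  _                  ∎
  where open ℕ.≤-Reasoning

unique-sublist : {A : Set} {xs ys : List A} → xs Sublist.⊆ ys → Unique ys → Unique xs
unique-sublist Sublist.[]            u        = []
unique-sublist (y Sublist.∷ʳ s)      (_ ∷ u)  = unique-sublist s u
unique-sublist (refl Sublist.∷ s)    (y∉ ∷ u) = Sublist.All-resp-⊆ s y∉ ∷ unique-sublist s u

argmax : {q : ℕ} (w : Fin q → ℕ) → Fin q → ∃ λ i → ∀ j → w j ≤ w i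
argmax {suc zero}    w _ = zero , λ { zero → ℕ.≤-refl }
argmax {suc (suc q)} w _ with argmax (w ∘ suc) zero
... | i , max with ℕ.≤-total (w zero) (w (suc i))
...   | inj₁ le = suc i , λ { zero → le ; (suc j) → max j }
...   | inj₂ ge = zero , λ { zero → ℕ.≤-refl ; (suc j) → ℕ.≤-trans (max j) ge }

module Good (G : Graph n) (W : DPGoodWitness G) where
  open DPGoodWitness W
  open CycleAt

  private
    E = edgeList G

  ℓ : Fin q → ℕ
  ℓ i = len (C i)

  ℓ≤n : ∀ i → ℓ i ≤ n
  ℓ≤n i = Fin.injective⇒≤ (inj (C i))

  e∈E : ∀ i → e i ∈ E
  e∈E i = edgeList-complete G (e-ord i) (e-edge i)

  minimal : ∀ i {x y xs} → norm x y ≡ e i → Chain (λ a b → adj G a b ≡ true) x xs y → Unique xs →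
            3 ≤ length xs → ℓ i ≤ length xs
  minimal i {x} {y} ends c un long =
    let xy = norm-elim (λ a b → adj G a b ≡ true) (adj-sym G) x y
               (subst (λ g → adj G (proj₁ g) (proj₂ g) ≡ true) (sym ends) (e-edge i))
        C′ , len≡ , st = chain⇒cycle c un long (adj-sym G xy)
    in subst (ℓ i ≤_) len≡ (proj₂ (C-min i) C′
         (subst (λ g → CycleEdge C′ (proj₁ g) (proj₂ g)) ends
           (norm-intro (CycleEdge C′) [ inj₂ , inj₁ ]′ x y (inj₂ st))))

  -- The edges of a cycle of even-sized S are not all of S, as the cycle is odd; an extra edge of S
  -- leaves the cycle or is a chord, and a chord yields a shorter cycle through e i.
  even-rank : ∀ m .{{_ : NonZero m}} {S} → S Sublist.⊆ E → oddLength S ≡ false → ∀ i → e i ∈ S →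
              CycleAt (Joined S) (e i) → N {m = m} ι S * m ^ ℓ i ≤ m ^ n
  even-rank m {S} S⊆E even i ei∈S (cycleAt {x} {y} {xs} ends c un long)
    with ℕ.m≤n⇒m<n∨m≡n (minimal i ends (chain-map (λ r → joined⇒adj G (Sublist.lookup S⊆E r)) c) un long)
  -- A cycle longer than `ℓ i` already gains the required factor `m` from its extra vertex.
  ... | inj₁ ℓ< = ℕ.*-cancelˡ-≤ m (begin
    m * (N ι S * m ^ ℓ i)  ≡⟨ trans (sym (ℕ.*-assoc m (N ι S) _)) (trans (cong (_* m ^ ℓ i) (ℕ.*-comm m (N ι S))) (ℕ.*-assoc (N ι S) m _)) ⟩
    N ι S * m ^ suc (ℓ i)  ≤⟨ ℕ.*-monoʳ-≤ (N ι S) (ℕ.^-monoʳ-≤ m ℓ<) ⟩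
    N ι S * m ^ length xs  ≤⟨ N-path m un c ⟩
    m * m ^ n              ∎)
    where open ℕ.≤-Reasoning
  ... | inj₂ ℓ≡ with all? (λ g → any? (proj₁ g ≟_) xs ×-dec any? (proj₂ g ≟_) xs) S
  ...   | no ¬all with g , g∈S , out ← find (¬All⇒Any¬ (λ g → any? (proj₁ g ≟_) xs ×-dec any? (proj₂ g ≟_) xs) S ¬all)
    = subst (λ l → N ι S * m ^ l ≤ m ^ n) (sym ℓ≡) (leave g g∈S out (any? (proj₁ g ≟_) xs))
    where
    leave : ∀ g → g ∈ S → ¬ (proj₁ g ∈ xs × proj₂ g ∈ xs) → Dec (proj₁ g ∈ xs) → N ι S * m ^ length xs ≤ m ^ n
    leave (p , r) g∈S out d = go d
      where
      p<r = proj₁ (edgeList-sound G (Sublist.lookup S⊆E g∈S))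
      pr : Joined S p r
      pr = subst (_∈ S) (sym (norm-ordered p<r)) g∈S
      p≢r : p ≢ r
      p≢r e = Fin.<-irrefl e p<r
      go : Dec (p ∈ xs) → N ι S * m ^ length xs ≤ m ^ n
      go (yes p∈) = N-path-extra m un c (p≢r ∘ sym) (λ r∈ → out (p∈ , r∈)) (Joined-sym S pr)
      go (no p∉)  = N-path-extra m un c p≢r p∉ pr
  ...   | yes inside = contradiction (trans (sym even) odd-S) (λ ())
    where
    Z = e i ∷ edges c
    adj-c = chain-map (λ r → joined⇒adj G (Sublist.lookup S⊆E r)) c
    S⊆Z : ∀ {g} → g ∈ S → g ∈ Z
    S⊆Z {p , r} g∈S with edgeList-sound G (Sublist.lookup S⊆E g∈S) | All.lookup inside g∈S
    ... | p<r , pr | p∈ , r∈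
      with shortcut c un p∈ r∈ (λ e → Fin.<-irrefl e p<r) (joined g∈S) (Joined-sym S (joined g∈S))
      where
      joined : (p , r) ∈ S → Joined S p r
      joined = subst (_∈ S) (sym (norm-ordered p<r))
    ... | inj₁ k = there (subst (_∈ edges c) (norm-ordered p<r) k)
    -- By minimality the shortened path has fewer than three vertices. It then consists of the chord
    -- alone, so the chord joins `x` to `y` and is `e i` itself.
    ... | inj₂ (ws , d , un′ , _ , lt , k) = here (trans (sym (norm-ordered p<r)) (trans (short d k tooShort) ends))
      where
      tooShort : ¬ 3 ≤ length ws
      tooShort l = ℕ.<⇒≱ lt (subst (_≤ length ws) ℓ≡
        (minimal i ends (chain-map (λ r → joined⇒adj G (Sublist.lookup S⊆E r)) d) un′ l))
      short : ∀ {g ws} (d : Chain (Joined S) x ws y) → g ∈ edges d → ¬ 3 ≤ length ws → g ≡ norm x y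
      short (_ ∷ [ _ ])     (here e) _ = e
      short (_ ∷ _ ∷ [ _ ]) _        b = contradiction (s≤s (s≤s (s≤s z≤n))) b
      short (_ ∷ _ ∷ _ ∷ _) _        b = contradiction (s≤s (s≤s (s≤s z≤n))) b
    Z⊆S : ∀ {g} → g ∈ Z → g ∈ S
    Z⊆S (here refl) = ei∈S
    Z⊆S (there k)   = edges-all (λ r → r) c k
    Z-unique : Unique Z
    Z-unique = ¬Any⇒All¬ _ (subst (_∉ edges c) ends (closing∉edges c un long)) ∷ edges-unique c un
    S-unique : Unique S
    S-unique = unique-sublist S⊆E (edgeList-unique G)
    length≡ : length S ≡ ℓ i
    length≡ = trans (ℕ.≤-antisym (unique-⊆-length S-unique S⊆Z) (unique-⊆-length Z-unique Z⊆S))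
      (trans (sym (length-edges c)) (sym ℓ≡))
    odd-S : oddLength S ≡ true
    odd-S = oddLength-odd S (proj₁ (odd i)) (trans length≡ (proj₂ (odd i)))

  -- A path has fewer than `suc n` edges, so twists smaller by this factor add up along it to at
  -- most half of `d (e i)`. The factor 2 provides the half.
  base : ℕ
  base = 2 * suc n

  -- There are at most `2 ^ length E` even sets, each with a deficit of at most
  -- `length E * (n * bound) / m`, and `bound` contains the factor `base ^ q` lost in comparing
  -- weights. The outer 2 answers the half that is lost in `odd-deficit`.
  threshold : ℕ
  threshold = 2 * (2 ^ length E * (length E * (n * base ^ q)))

  module Twisted (m : ℕ) .{{_ : NonZero m}} (σ : Transport n m)
                 (fixed-tree : ∀ {u v} → tadj T u v ≡ true → ∀ x → Fixed σ (norm u v) x) where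

    d : Edge n → ℕ
    d = twist σ

    tree-untwisted : ∀ {u v} → tadj T u v ≡ true → d (norm u v) ≡ 0
    tree-untwisted {u} {v} t = trans
      (∑-cong (allFin m) (λ x → 𝟙-no (moved? σ (norm u v) x) (λ ¬f → ¬f (fixed-tree t x)))) (∑-zero (allFin m))

    co : Fin q → ℕ
    co i = m ^ (n ∸ ℓ i)

    co-ℓ : ∀ i → co i * m ^ ℓ i ≡ m ^ n
    co-ℓ i = trans (sym (ℕ.^-distribˡ-+-* m (n ∸ ℓ i) (ℓ i))) (cong (m ^_) (ℕ.m∸n+n≡m (ℓ≤n i)))

    -- The factor base ^ (q ∸ i) makes twists of earlier edges on C i negligible for a maximal i.
    weight : Fin q → ℕ
    weight i = d (e i) * co i * base ^ (q ∸ toℕ i)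

    module Maximal (i : Fin q) (max : ∀ j → weight j ≤ weight i) where

      -- By `sorted`, `co j` is at least `co i`, and the weight of `j` has at least one more factor
      -- `base`. Since `i` is maximal, the difference must be made up by the twists.
      earlier : ∀ j → toℕ j < toℕ i → base * d (e j) ≤ d (e i)
      earlier j j<i = ℕ.*-cancelʳ-≤ (base * d (e j)) (d (e i)) (co i * base ^ (q ∸ toℕ i)) {{nz}} (begin
        base * d (e j) * (co i * base ^ (q ∸ toℕ i))
          ≡⟨ shuffle base (d (e j)) (co i) _ ⟩
        d (e j) * co i * base ^ suc (q ∸ toℕ i)
          ≤⟨ ℕ.*-mono-≤ (ℕ.*-monoʳ-≤ (d (e j)) (ℕ.^-monoʳ-≤ m (ℕ.∸-monoʳ-≤ n (sorted j i (ℕ.<⇒≤ j<i)))))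
                        (ℕ.^-monoʳ-≤ base (ℕ.∸-monoʳ-< j<i (ℕ.<⇒≤ (Fin.toℕ<n i)))) ⟩
        weight j
          ≤⟨ max j ⟩
        weight i
          ≡⟨ ℕ.*-assoc (d (e i)) (co i) _ ⟩
        d (e i) * (co i * base ^ (q ∸ toℕ i)) ∎)
        where
        open ℕ.≤-Reasoning
        nz : NonZero (co i * base ^ (q ∸ toℕ i))
        nz = ℕ.m*n≢0 (co i) (base ^ (q ∸ toℕ i)) {{ℕ.m^n≢0 m (n ∸ ℓ i)}} {{ℕ.m^n≢0 base (q ∸ toℕ i)}}
        shuffle : ∀ a b c k → a * b * (c * k) ≡ b * c * (a * k)
        shuffle = solve-∀

      bound : ℕ
      bound = d (e i) * co i * base ^ q

      dominates : ∀ j → co j * d (e j) ≤ bound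
      dominates j = begin
        co j * d (e j)   ≡⟨ ℕ.*-comm (co j) _ ⟩
        d (e j) * co j   ≤⟨ ℕ.m≤m*n _ (base ^ (q ∸ toℕ j)) {{ℕ.m^n≢0 base (q ∸ toℕ j)}} ⟩
        weight j         ≤⟨ max j ⟩
        weight i         ≤⟨ ℕ.*-monoʳ-≤ (d (e i) * co i) (ℕ.^-monoʳ-≤ base (ℕ.m∸n≤m q (toℕ i))) ⟩
        bound            ∎
        where open ℕ.≤-Reasoning

      -- Tree edges have twist 0. For any other edge `e j` on a cycle of `S`, `even-rank` gives
      -- `N ι S ≤ co j`, and `dominates` then supplies the bound that `deficit-upper` asks for.
      even-deficit : ∀ {S} → S ∈ subs false E → m * N {m = m} ι S ≤ m * N σ S + length E * (n * bound)
      even-deficit {S} S∈ with subs-sound false E S∈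
      ... | even , S⊆E = ℕ.≤-trans
        (deficit-upper (forest σ S ord) ord bound small)
        (ℕ.+-monoʳ-≤ (m * N σ S) (ℕ.*-monoˡ-≤ (n * bound) (Sublist.length-mono-≤ S⊆E)))
        where
        ord : All Ordered S
        ord = All.tabulate (λ k → proj₁ (edgeList-sound G (Sublist.lookup S⊆E k)))
        small : ∀ {g} → g ∈ S → CycleAt (Joined S) g → N {m = m} ι S * d g ≤ bound
        small {u , v} g∈ Z with edgeList-sound G (Sublist.lookup S⊆E g∈) | tadj T u v in t
        ... | u<v , uv | true = ℕ.≤-trans (ℕ.≤-reflexive (trans (cong (N {m = m} ι S *_)
          (trans (cong d (sym (norm-ordered u<v))) (tree-untwisted t))) (ℕ.*-zeroʳ (N {m = m} ι S)))) z≤n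
        ... | u<v , uv | false with e-surj u v u<v uv t
        ...   | j , refl = ℕ.≤-trans (ℕ.*-monoˡ-≤ (d (e j)) N≤co) (dominates j)
          where
          N≤co : N {m = m} ι S ≤ co j
          N≤co = ℕ.*-cancelʳ-≤ _ _ (m ^ ℓ j) {{ℕ.m^n≢0 m (ℓ j)}}
            (subst (N {m = m} ι S * m ^ ℓ j ≤_) (sym (co-ℓ j)) (even-rank m S⊆E even j g∈ Z))

      private
        Zi = cycleEdge⇒cycleAt (C i) (proj₁ (C-min i))
        Z = proj₁ Zi
        c = path Z

      ends-Z : norm (a Z) (b Z) ≡ e i
      ends-Z = trans (ends Z) (norm-ordered (e-ord i))

      cycleEdge-adj : ∀ {u v} → CycleEdge (C i) u v → adj G u v ≡ true
      cycleEdge-adj (inj₁ (mid t)) = steps (C i) t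
      cycleEdge-adj (inj₁ wrap)    = close (C i)
      cycleEdge-adj (inj₂ (mid t)) = adj-sym G (steps (C i) t)
      cycleEdge-adj (inj₂ wrap)    = adj-sym G (close (C i))

      cycleEdges : List (Edge n)
      cycleEdges = e i ∷ edges c

      cycleEdges⊆E : ∀ {g} → g ∈ cycleEdges → g ∈ E
      cycleEdges⊆E (here refl) = e∈E i
      cycleEdges⊆E (there k)   = edges-all (λ r → norm∈edgeList G (cycleEdge-adj r)) c k

      -- Filtering `E` lists the edges of `C i` in the order of `E`, so that they form one of the
      -- sublists in the expansion.
      S : List (Edge n)
      S = filter (_∈ᵉ? cycleEdges) E

      S⊆cycleEdges : ∀ {g} → g ∈ S → g ∈ cycleEdges
      S⊆cycleEdges = proj₂ ∘ ∈-filter⁻ (_∈ᵉ? cycleEdges) {xs = E}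

      cycleEdges⊆S : ∀ {g} → g ∈ cycleEdges → g ∈ S
      cycleEdges⊆S k = ∈-filter⁺ (_∈ᵉ? cycleEdges) (cycleEdges⊆E k) k

      ei∉path : e i ∉ edges c
      ei∉path = subst (_∉ edges c) ends-Z (closing∉edges c (distinct Z) (long Z))

      S∈subs : S ∈ subs true E
      S∈subs = subst (λ p → S ∈ subs p E) (oddLength-odd S (proj₁ (odd i)) (trans length≡ (proj₂ (odd i))))
        (subs-complete (Sublist.filter-⊆ (_∈ᵉ? cycleEdges) E))
        where
        length≡ : length S ≡ ℓ i
        length≡ = trans (ℕ.≤-antisym
          (unique-⊆-length (Unique.filter⁺ (_∈ᵉ? cycleEdges) (edgeList-unique G)) S⊆cycleEdges)
          (unique-⊆-length (¬Any⇒All¬ _ ei∉path ∷ edges-unique c (distinct Z)) cycleEdges⊆S))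
          (trans (sym (length-edges c)) (proj₂ Zi))

      -- By `inside`, an edge of `C i` lies in the tree or is some `e j` with `j` at most `i`. The
      -- path is `C i` cut open at `e i`, which rules out `j = i`.
      light : ∀ {g} → g ∈ edges c → base * d g ≤ d (e i)
      light k = edges-all {Q = λ g → g ∈ edges c → base * d g ≤ d (e i)} cycleEdge-light c k k
        where
        later : ∀ {u v} j → toℕ j ≤ toℕ i → e j ≡ norm u v → norm u v ∈ edges c → base * d (norm u v) ≤ d (e i)
        later {u} {v} j j≤i eq k with ℕ.m≤n⇒m<n∨m≡n j≤i
        ... | inj₁ j<i = subst (λ g → base * d g ≤ d (e i)) eq (earlier j j<i)
        ... | inj₂ j≡i with Fin.toℕ-injective j≡i
        ...   | refl = contradiction (subst (_∈ edges c) (sym eq) k) ei∉path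
        cycleEdge-light : ∀ {u v} → CycleEdge (C i) u v → norm u v ∈ edges c → base * d (norm u v) ≤ d (e i)
        cycleEdge-light {u} {v} r k with inside i u v r
        ... | inj₁ t = ℕ.≤-trans (ℕ.≤-reflexive (trans (cong (base *_) (tree-untwisted t)) (ℕ.*-zeroʳ base))) z≤n
        ... | inj₂ (j , j≤i , inj₁ p) = later j j≤i
          (trans p (sym (norm-ordered (subst Ordered p (e-ord j))))) k
        ... | inj₂ (j , j≤i , inj₂ p) = later j j≤i
          (trans p (trans (sym (norm-ordered (subst Ordered p (e-ord j)))) (norm-comm v u))) k

      -- In `deficit-lower` the twists on the path take back at most half of `d (e i) * N₀`. The
      -- remaining half is large because all edges of `S` lie on the `ℓ i` vertices of the cycle,
      -- whence `N₀` is at least `m * co i`.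
      odd-deficit : 2 * m * N σ S + d (e i) * co i * m ≤ 2 * m * N {m = m} ι S
      odd-deficit = ℕ.+-cancelʳ-≤ (d (e i) * N₀) _ _ (begin
        2 * m * N σ S + d (e i) * co i * m + d (e i) * N₀
          ≡⟨ cong (λ t → 2 * m * N σ S + t + d (e i) * N₀) (trans (ℕ.*-assoc (d (e i)) (co i) m) (cong (d (e i) *_) (ℕ.*-comm (co i) m))) ⟩
        2 * m * N σ S + d (e i) * (m * co i) + d (e i) * N₀
          ≤⟨ ℕ.+-monoˡ-≤ (d (e i) * N₀) (ℕ.+-monoʳ-≤ (2 * m * N σ S) (ℕ.*-monoʳ-≤ (d (e i)) mco≤N₀)) ⟩
        2 * m * N σ S + d (e i) * N₀ + d (e i) * N₀
          ≡⟨ double m (N σ S) (d (e i) * N₀) ⟩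
        2 * (m * N σ S + d (e i) * N₀)
          ≤⟨ ℕ.*-monoʳ-≤ 2 (deficit-lower (forest σ S ord) ends-Z (cycleEdges⊆S (here refl)) c (cycleEdges⊆S ∘ there)) ⟩
        2 * (m * N₀ + ∑ (edges c) (λ g → d g * N₀))
          ≡⟨ trans (ℕ.*-distribˡ-+ 2 (m * N₀) _) (cong (_+ 2 * ∑ (edges c) (λ g → d g * N₀)) (sym (ℕ.*-assoc 2 m N₀))) ⟩
        2 * m * N₀ + 2 * ∑ (edges c) (λ g → d g * N₀)
          ≤⟨ ℕ.+-monoʳ-≤ (2 * m * N₀) path-small ⟩
        2 * m * N₀ + d (e i) * N₀ ∎)
        where
        open ℕ.≤-Reasoning
        N₀ = N {m = m} ι S
        double : ∀ m s t → 2 * m * s + t + t ≡ 2 * (m * s + t)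
        double = solve-∀
        ord : All Ordered S
        ord = All.tabulate (λ k → proj₁ (edgeList-sound G (cycleEdges⊆E (S⊆cycleEdges k))))
        ends-within : ∀ {g} → g ∈ cycleEdges → proj₁ g ∈ verts Z × proj₂ g ∈ verts Z
        ends-within (here refl) = subst (λ g → proj₁ g ∈ verts Z × proj₂ g ∈ verts Z) ends-Z
          (norm-intro (λ a b → a ∈ verts Z × b ∈ verts Z) (λ { (p , r) → r , p }) (a Z) (b Z) (chain-head c , chain-last c))
        ends-within {g} (there k) = edges-ends c (subst (_∈ edges c) (sym (norm-ordered (proj₁ (edgeList-sound G (cycleEdges⊆E (there k)))))) k)
        mco≤N₀ : m * co i ≤ N₀
        mco≤N₀ = ℕ.*-cancelʳ-≤ _ _ (m ^ ℓ i) {{ℕ.m^n≢0 m (ℓ i)}} (begin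
          m * co i * m ^ ℓ i       ≡⟨ trans (ℕ.*-assoc m (co i) _) (cong (m *_) (co-ℓ i)) ⟩
          m * m ^ n                ≤⟨ within (verts Z) (chain-cons c) (distinct Z) (ends-within ∘ S⊆cycleEdges) ⟩
          N₀ * m ^ length (verts Z) ≡⟨ cong (λ l → N₀ * m ^ l) (proj₂ Zi) ⟩
          N₀ * m ^ ℓ i             ∎)
          where
          within : ∀ xs → (∃ λ ws → xs ≡ a Z ∷ ws) → Unique xs → (∀ {g} → g ∈ S → proj₁ g ∈ xs × proj₂ g ∈ xs) →
                   m * m ^ n ≤ N₀ * m ^ length xs
          within _ (ws , refl) un ins = N-within m un ins
        path-small : 2 * ∑ (edges c) (λ g → d g * N₀) ≤ d (e i) * N₀
        path-small = ℕ.*-cancelˡ-≤ (suc n) (begin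
          suc n * (2 * ∑ (edges c) (λ g → d g * N₀))
            ≡⟨ trans (sym (ℕ.*-assoc (suc n) 2 (∑ (edges c) (λ g → d g * N₀)))) (cong (_* ∑ (edges c) (λ g → d g * N₀)) (ℕ.*-comm (suc n) 2)) ⟩
          base * ∑ (edges c) (λ g → d g * N₀)
            ≡⟨ ∑-* base (edges c) _ ⟨
          ∑ (edges c) (λ g → base * (d g * N₀))
            ≤⟨ ∑-bounded (edges c) (λ {g} k → subst (_≤ d (e i) * N₀) (ℕ.*-assoc base (d g) N₀) (ℕ.*-monoˡ-≤ N₀ (light k))) ⟩
          length (edges c) * (d (e i) * N₀)
            ≤⟨ ℕ.*-monoˡ-≤ (d (e i) * N₀) (ℕ.≤-trans (ℕ.n≤1+n _) (ℕ.≤-trans (subst (_≤ n) (length-edges c) (unique-length≤ (distinct Z))) (ℕ.n≤1+n n))) ⟩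
          suc n * (d (e i) * N₀) ∎)

      -- Multiplying by `2 * m` clears the half of the odd deficit and the denominator of the even
      -- ones. The odd sets then gain at least `X * m` and the even sets lose at most
      -- `X * threshold`. `Oσ` is added on both sides since the expansions carry the odd sums on the
      -- left.
      compare : threshold < m → 0 < d (e i) → colourings {m = m} G ι < colourings G σ
      compare large pos = ℕ.*-cancelˡ-< (2 * m) Pι Pσ (ℕ.+-cancelʳ-< (2 * m * Oσ + X * threshold) _ _ (begin-strict
        2 * m * Pι + (2 * m * Oσ + X * threshold)
          <⟨ ℕ.+-monoʳ-< (2 * m * Pι) (ℕ.+-monoʳ-< (2 * m * Oσ) (ℕ.*-monoʳ-< X {{>-nonZero X>0}} large)) ⟩
        2 * m * Pι + (2 * m * Oσ + X * m)
          ≤⟨ ℕ.+-monoʳ-≤ (2 * m * Pι) odd-sum ⟩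
        2 * m * Pι + 2 * m * Oι
          ≡⟨ trans (sym (ℕ.*-distribˡ-+ (2 * m) Pι Oι)) (cong (2 * m *_) (colourings-expansion G ι)) ⟩
        2 * m * Vι
          ≤⟨ even-sum ⟩
        2 * m * Vσ + X * threshold
          ≡⟨ cong (λ t → 2 * m * t + X * threshold) (colourings-expansion G σ) ⟨
        2 * m * (Pσ + Oσ) + X * threshold
          ≡⟨ regroup (2 * m) Pσ Oσ (X * threshold) ⟩
        2 * m * Pσ + (2 * m * Oσ + X * threshold) ∎))
        where
        open ℕ.≤-Reasoning
        Pι Pσ Oι Oσ Vι Vσ X : ℕ
        Pι = colourings {m = m} G ι
        Pσ = colourings G σ
        Oι = ∑ (subs true E) (N {m = m} ι)
        Oσ = ∑ (subs true E) (N σ)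
        Vι = ∑ (subs false E) (N {m = m} ι)
        Vσ = ∑ (subs false E) (N σ)
        X = d (e i) * co i
        X>0 : 0 < X
        X>0 = ℕ.*-mono-< pos (ℕ.m^n>0 m (n ∸ ℓ i))
        regroup : ∀ a p o t → a * (p + o) + t ≡ a * p + (a * o + t)
        regroup = solve-∀
        odd-sum : 2 * m * Oσ + X * m ≤ 2 * m * Oι
        odd-sum = begin
          2 * m * Oσ + X * m                             ≡⟨ cong (_+ X * m) (∑-* (2 * m) (subs true E) (N σ)) ⟨
          ∑ (subs true E) (λ A → 2 * m * N σ A) + X * m  ≤⟨ ∑-gap (λ A∈ → ℕ.*-monoʳ-≤ (2 * m) (N-≤ (forest σ _ (ord A∈)))) S∈subs odd-deficit ⟩
          ∑ (subs true E) (λ A → 2 * m * N {m = m} ι A)  ≡⟨ ∑-* (2 * m) (subs true E) (N {m = m} ι) ⟩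
          2 * m * Oι ∎
          where
          ord : ∀ {A} → A ∈ subs true E → All Ordered A
          ord A∈ = All.tabulate (λ k → proj₁ (edgeList-sound G (Sublist.lookup (proj₂ (subs-sound true E A∈)) k)))
        even-sum : 2 * m * Vι ≤ 2 * m * Vσ + X * threshold
        even-sum = begin
          2 * m * Vι
            ≡⟨ trans (ℕ.*-assoc 2 m Vι) (cong (2 *_) (sym (∑-* m (subs false E) (N {m = m} ι)))) ⟩
          2 * ∑ (subs false E) (λ A → m * N {m = m} ι A)
            ≤⟨ ℕ.*-monoʳ-≤ 2 (∑-mono (subs false E) even-deficit) ⟩
          2 * ∑ (subs false E) (λ A → m * N σ A + length E * (n * bound))
            ≡⟨ cong (2 *_) (trans (∑-+ (subs false E) _ _) (cong₂ _+_ (∑-* m (subs false E) (N σ)) (∑-const (subs false E) _))) ⟩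
          2 * (m * Vσ + length (subs false E) * (length E * (n * bound)))
            ≤⟨ ℕ.*-monoʳ-≤ 2 (ℕ.+-monoʳ-≤ (m * Vσ) (ℕ.*-monoˡ-≤ _ (length-subs false E))) ⟩
          2 * (m * Vσ + 2 ^ length E * (length E * (n * (X * base ^ q))))
            ≡⟨ collect m Vσ (2 ^ length E) (length E) n X (base ^ q) ⟩
          2 * m * Vσ + X * threshold ∎
          where
          collect : ∀ m v p l n x b → 2 * (m * v + p * (l * (n * (x * b)))) ≡ 2 * m * v + x * (2 * (p * (l * (n * b))))
          collect = solve-∀

    -- One moved point makes some weight positive, hence also the maximal one, so the maximal index
    -- is itself twisted.
    twisted : threshold < m → ∀ j → 0 < d (e j) → colourings {m = m} G ι < colourings G σ
    twisted large j pos with argmax weight j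
    ... | i , max = Maximal.compare i max large (ℕ.n≢0⇒n>0 (λ d≡0 → ℕ.<⇒≱ wj>0
      (subst (weight j ≤_) (cong (λ t → t * co i * base ^ (q ∸ toℕ i)) d≡0) (max j))))
      where
      wj>0 : 0 < weight j
      wj>0 = ℕ.*-mono-< (ℕ.*-mono-< pos (ℕ.m^n>0 m (n ∸ ℓ j))) (ℕ.m^n>0 base (q ∸ toℕ j))

-- Arbitrary covers

==ᶠ⇒≡ : {i j : Fin n} → (i ==ᶠ j) ≡ true → i ≡ j
==ᶠ⇒≡ {i = i} {j} e with i ≟ j
... | yes p = p
==ᶠ⇒≡ () | no _

≡⇒==ᶠ : {i j : Fin n} → i ≡ j → (i ==ᶠ j) ≡ true
≡⇒==ᶠ {i = i} {j} p with i ≟ j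
... | yes _ = refl
... | no ¬p = contradiction p ¬p

true-⇔ : {a b : Bool} → (a ≡ true → b ≡ true) → (b ≡ true → a ≡ true) → a ≡ b
true-⇔ {true}  {b}     f g = sym (f refl)
true-⇔ {false} {true}  f g = g refl
true-⇔ {false} {false} f g = refl

allF-intro : (k : ℕ) (p : Fin k → Bool) → (∀ i → p i ≡ true) → allF k p ≡ true
allF-intro zero    p h = refl
allF-intro (suc k) p h rewrite h zero = allF-intro k (p ∘ suc) (h ∘ suc)

allF-elim : (k : ℕ) (p : Fin k → Bool) → allF k p ≡ true → ∀ i → p i ≡ true
allF-elim (suc k) p h i with p zero in eq
allF-elim (suc k) p h zero    | true = eq
allF-elim (suc k) p h (suc i) | true = allF-elim k (p ∘ suc) h i

allF-cong : (k : ℕ) {p r : Fin k → Bool} → (∀ i → p i ≡ r i) → allF k p ≡ allF k r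
allF-cong zero    e = refl
allF-cong (suc k) e = cong₂ _∧_ (e zero) (allF-cong k (e ∘ suc))

sumF-cong : (k : ℕ) {h g : Fin k → ℕ} → (∀ i → h i ≡ g i) → sumF k h ≡ sumF k g
sumF-cong zero    e = refl
sumF-cong (suc k) e = cong₂ _+_ (e zero) (sumF-cong k (e ∘ suc))

sumF-const : (k c : ℕ) → sumF k (λ _ → c) ≡ k * c
sumF-const zero    c = refl
sumF-const (suc k) c = cong (c +_) (sumF-const k c)

P≤colourings : (G : Graph n) (m : ℕ) → P G m ≤ colourings {m = m} G ι
P≤colourings {n} G m = begin
  P G m
    ≡⟨ count-∑ (isProper G) (allFuns (allFin m) n) ⟩
  ∑ (allFuns (allFin m) n) (λ f → 𝟙 (isProper G f Bool.≟ true))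
    ≡⟨ ∑-allFuns (allFin m) n _ (λ f g e → cong (λ b → 𝟙 (b Bool.≟ true)) (ext f g e)) ⟩
  ∑ (vecs (allFin m) n) (λ f → 𝟙 (isProper G (lookup f) Bool.≟ true))
    ≤⟨ ∑-mono (vecs (allFin m) n) (λ {f} _ → 𝟙-mono (isProper G (lookup f) Bool.≟ true)
         (all? (λ e → ¬? (agree? ι f e)) (edgeList G)) (proper f)) ⟩
  colourings {m = m} G ι ∎
  where
  open ℕ.≤-Reasoning
  ext : ∀ f g → (∀ i → f i ≡ g i) → isProper {m = m} G f ≡ isProper G g
  ext f g e = allF-cong n (λ u → allF-cong n (λ v → cong₂ (λ a b → not (adj G u v ∧ (a ==ᶠ b))) (e u) (e v)))
  proper : (f : Vec (Fin m) n) → isProper G (lookup f) ≡ true → All (λ e → ¬ Agree ι f e) (edgeList G)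
  proper f p = All.tabulate (λ { {u , v} i a → conflict u v (proj₂ (edgeList-sound G i)) a })
    where
    conflict : ∀ u v → adj G u v ≡ true → ¬ (lookup f u ≡ lookup f v)
    conflict u v uv a with allF-elim n _ (allF-elim n _ p u) v
    ... | h rewrite uv | ≡⇒==ᶠ a with h
    ... | ()

module _ {A B : Set} (_~_ : A → A → Set) (~-refl : ∀ {a} → a ~ a) (xs : List A) (ys : List B) (g : B → A)
         (∑-embed : (h : A → ℕ) → (∀ a b → a ~ b → h a ≡ h b) → ∑ ys (h ∘ g) ≤ ∑ xs h) where

  -- In `allSubsets` the values of the listed functions are again functions, so equality of values
  -- is weakened to `_~_`. An embedding of `ys` into `xs`, expressed by sums of functions that
  -- respect `_~_`, is lifted one coordinate at a time.
  ∑-allFuns-embed : (n : ℕ) (h : (Fin n → A) → ℕ) → (∀ f f′ → (∀ i → f i ~ f′ i) → h f ≡ h f′) →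
                    ∑ (vecs ys n) (λ v → h (g ∘ lookup v)) ≤ ∑ (allFuns xs n) h
  ∑-allFuns-embed zero    h ext = ℕ.≤-reflexive (cong (_+ 0) (ext _ _ (λ ())))
  ∑-allFuns-embed (suc n) h ext = begin
    ∑ (vecs ys (suc n)) (λ v → h (g ∘ lookup v))
      ≡⟨ ∑-vecs ys n _ ⟩
    ∑ ys (λ b → ∑ (vecs ys n) (λ v → h (g ∘ lookup (b ∷ v))))
      ≡⟨ ∑-cong ys (λ b → ∑-cong (vecs ys n) (λ v → ext _ _ (λ { zero → ~-refl ; (suc i) → ~-refl }))) ⟩
    ∑ ys (λ b → ∑ (vecs ys n) (λ v → h (g b ∷ᶠ (g ∘ lookup v))))
      ≤⟨ ∑-mono ys (λ {b} _ → ∑-allFuns-embed n (λ f → h (g b ∷ᶠ f))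
           (λ f f′ e → ext _ _ (λ { zero → ~-refl ; (suc i) → e i }))) ⟩
    ∑ ys (λ b → ∑ (allFuns xs n) (λ f → h (g b ∷ᶠ f)))
      ≤⟨ ∑-embed (λ a → ∑ (allFuns xs n) (λ f → h (a ∷ᶠ f)))
           (λ a a′ r → ∑-cong (allFuns xs n) (λ f → ext _ _ (λ { zero → r ; (suc i) → ~-refl }))) ⟩
    ∑ xs (λ a → ∑ (allFuns xs n) (λ f → h (a ∷ᶠ f)))
      ≡⟨ ∑-allFuns-suc xs n h (λ f f′ e → ext f f′ (λ i → subst (f i ~_) (e i) ~-refl)) ⟨
    ∑ (allFuns xs (suc n)) h ∎
    where open ℕ.≤-Reasoning

-- The indicators of single points occupy different places in the list: that of `zero` lies in the
-- half with first value `true`, all others in the half with first value `false`.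
singletons : (m : ℕ) (h : (Fin m → Bool) → ℕ) → (∀ f g → (∀ i → f i ≡ g i) → h f ≡ h g) →
             ∑ (allFin m) (λ i → h (i ==ᶠ_)) ≤ ∑ (allFuns (true ∷ false ∷ []) m) h
singletons zero    h ext = z≤n
singletons (suc m) h ext = begin
  h (zero ==ᶠ_) + ∑ (List.tabulate suc) (λ i → h (i ==ᶠ_))
    ≡⟨ cong₂ _+_ (ext _ _ (λ { zero → refl ; (suc j) → sym (lookup-replicate j false) }))
         (trans (cong (λ l → ∑ l (λ i → h (i ==ᶠ_))) (sym (map-tabulate (λ i → i) suc))) (∑-map suc (allFin m) _)) ⟩
  h (true ∷ᶠ lookup (replicate m false)) + ∑ (allFin m) (λ i → h (suc i ==ᶠ_))
    ≤⟨ ℕ.+-mono-≤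
         (∑-member (λ f → h (true ∷ᶠ lookup f)) (∈-vecs (replicate m false)
           (λ i → subst (_∈ _) (sym (lookup-replicate i false)) (there (here refl)))))
         (ℕ.≤-trans (ℕ.≤-reflexive (∑-cong (allFin m) (λ i → ext _ _ (λ { zero → refl ; (suc j) → suc-==ᶠ i j }))))
                    (singletons m (λ f → h (false ∷ᶠ f)) (λ f g e → ext _ _ (λ { zero → refl ; (suc j) → e j })))) ⟩
  ∑ (vecs bools m) (λ f → h (true ∷ᶠ lookup f)) + ∑ (allFuns bools m) (λ f → h (false ∷ᶠ f))
    ≡⟨ cong₂ _+_ (sym (∑-allFuns bools m (λ f → h (true ∷ᶠ f)) (λ f g e → ext _ _ (λ { zero → refl ; (suc j) → e j }))))
                 (sym (ℕ.+-identityʳ _)) ⟩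
  ∑ bools (λ a → ∑ (allFuns bools m) (λ f → h (a ∷ᶠ f)))
    ≡⟨ ∑-allFuns-suc bools m h ext ⟨
  ∑ (allFuns bools (suc m)) h ∎
  where
  open ℕ.≤-Reasoning
  bools = true ∷ false ∷ []
  suc-==ᶠ : ∀ i (j : Fin m) → (suc i ==ᶠ suc j) ≡ (i ==ᶠ j)
  suc-==ᶠ i j = true-⇔ (≡⇒==ᶠ ∘ Fin.suc-injective ∘ ==ᶠ⇒≡) (≡⇒==ᶠ ∘ cong suc ∘ ==ᶠ⇒≡)

sumF-singleton : (m : ℕ) (c : Fin m) → sumF m (λ i → if c ==ᶠ i then 1 else 0) ≡ 1
sumF-singleton (suc m) zero    = cong suc (trans (sumF-const m 0) (ℕ.*-zeroʳ m))
sumF-singleton (suc m) (suc c) = trans (sumF-cong m (λ i → cong (if_then 1 else 0)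
  (true-⇔ {suc c ==ᶠ suc i} {c ==ᶠ i} (≡⇒==ᶠ ∘ Fin.suc-injective ∘ ==ᶠ⇒≡) (≡⇒==ᶠ ∘ cong suc ∘ ==ᶠ⇒≡))))
  (sumF-singleton m c)

module _ {G : Graph n} (H : Cover G m) where

  Unmatched : Vec (Fin m) n → Edge n → Set
  Unmatched f (u , v) = match H u v (lookup f u) (lookup f v) ≡ false

  unmatched? : (f : Vec (Fin m) n) (e : Edge n) → Dec (Unmatched f e)
  unmatched? f (u , v) = match H u v (lookup f u) (lookup f v) Bool.≟ false

  unmatched-all : ∀ f → All (Unmatched f) (edgeList G) → ∀ u v → match H u v (lookup f u) (lookup f v) ≡ false
  unmatched-all f k u v with adj G u v in uv
  ... | false = ¬-not (λ t → contradiction (trans (sym uv) (match-adj H u v _ _ t)) (λ ()))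
  ... | true with Fin.<-cmp u v
  ...   | tri< u<v _ _  = All.lookup k (edgeList-complete G u<v uv)
  ...   | tri≈ _ refl _ = contradiction refl (adj-distinct G uv)
  ...   | tri> _ _ v<u  = trans (match-sym H u v _ _) (All.lookup k (edgeList-complete G v<u (adj-sym G uv)))

  graphOf : Vec (Fin m) n → Subset n m
  graphOf f u i = lookup f u ==ᶠ i

  graphOf-independent : ∀ f → All (Unmatched f) (edgeList G) → isIndependent H (graphOf f) ≡ true
  graphOf-independent f k = allF-intro n _ λ u → allF-intro m _ λ i → allF-intro n _ λ v → allF-intro m _ λ j → go u i v j
    where
    go : ∀ u i v j → not (graphOf f u i ∧ graphOf f v j ∧ hAdj H (u , i) (v , j)) ≡ true
    go u i v j with graphOf f u i in p | graphOf f v j in r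
    ... | false | _     = refl
    ... | true  | false = refl
    ... | true  | true with refl ← ==ᶠ⇒≡ {i = lookup f u} p | refl ← ==ᶠ⇒≡ {i = lookup f v} r
      rewrite unmatched-all f k u v = cong not (clique (u ≟ v))
      where
      clique : Dec (u ≡ v) → ((u ==ᶠ v) ∧ not (lookup f u ==ᶠ lookup f v)) ∨ false ≡ false
      clique (yes refl) rewrite ≡⇒==ᶠ {i = u} refl | ≡⇒==ᶠ {i = lookup f u} refl = refl
      clique (no u≢v) rewrite ¬-not (u≢v ∘ ==ᶠ⇒≡) = refl

  size-graphOf : ∀ f → size (graphOf f) ≡ n
  size-graphOf f = trans (sumF-cong n (λ u → sumF-singleton m (lookup f u))) (trans (sumF-const n 1) (ℕ.*-identityʳ n))

  -- A function that avoids all matched pairs gives an independent set through its graph. Applied at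
  -- every vertex of `G`, `singletons` ensures that different functions use different entries of
  -- `allSubsets`.
  independent≤PDP : ∑ (vecs (allFin m) n) (λ f → 𝟙 (all? (unmatched? f) (edgeList G))) ≤ PDP H
  independent≤PDP = begin
    ∑ (vecs (allFin m) n) (λ f → 𝟙 (all? (unmatched? f) (edgeList G)))
      ≤⟨ ∑-mono (vecs (allFin m) n) (λ {f} _ → 𝟙-mono (all? (unmatched? f) (edgeList G)) (p (graphOf f) Bool.≟ true) (good f)) ⟩
    ∑ (vecs (allFin m) n) (λ f → 𝟙 (p (graphOf f) Bool.≟ true))
      ≤⟨ ∑-allFuns-embed (λ s t → ∀ i → s i ≡ t i) (λ _ → refl) (allFuns (true ∷ false ∷ []) m) (allFin m) _==ᶠ_
           (singletons m) n (λ S → 𝟙 (p S Bool.≟ true)) (λ S S′ e → cong (λ b → 𝟙 (b Bool.≟ true)) (ext S S′ e)) ⟩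
    ∑ (allSubsets n m) (λ S → 𝟙 (p S Bool.≟ true))
      ≡⟨ count-∑ p (allSubsets n m) ⟨
    PDP H ∎
    where
    open ℕ.≤-Reasoning
    p : Subset n m → Bool
    p S = isIndependent H S ∧ ⌊ size S ℕ.≟ n ⌋
    ext : ∀ S S′ → (∀ u i → S u i ≡ S′ u i) → p S ≡ p S′
    ext S S′ e = cong₂ (λ a b → a ∧ ⌊ b ℕ.≟ n ⌋)
      (allF-cong n λ u → allF-cong m λ i → allF-cong n λ v → allF-cong m λ j →
        cong₂ (λ a b → not (a ∧ b ∧ hAdj H (u , i) (v , j))) (e u i) (e v j))
      (sumF-cong n λ u → sumF-cong m λ i → cong (if_then 1 else 0) (e u i))
    good : ∀ f → All (Unmatched f) (edgeList G) → p (graphOf f) ≡ true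
    good f k rewrite graphOf-independent f k with size (graphOf f) ℕ.≟ n
    ... | yes _ = refl
    ... | no ¬p = contradiction (size-graphOf f) ¬p

perm-injective : (π : Permutation′ m) → ∀ {x y} → π ⟨$⟩ʳ x ≡ π ⟨$⟩ʳ y → x ≡ y
perm-injective π e = trans (sym (inverseˡ π)) (trans (cong (π ⟨$⟩ˡ_) e) (inverseˡ π))

transpose-other : {i j k : Fin m} → k ≢ i → k ≢ j → transpose i j ⟨$⟩ʳ k ≡ k
transpose-other {i = i} {j} {k} k≢i k≢j with k ≟ i
... | yes p = contradiction p k≢i
... | no _ with k ≟ j
...   | yes p = contradiction p k≢j
...   | no _  = refl

-- Compose π with the transposition of π i and j for each matched pair i, j in turn; it moves no value assigned before.
extend-matching : (r : Fin m → Fin m → Bool) →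
  (∀ i j j′ → r i j ≡ true → r i j′ ≡ true → j ≡ j′) → (∀ i i′ j → r i j ≡ true → r i′ j ≡ true → i ≡ i′) →
  ∃ λ (π : Permutation′ m) → ∀ i j → r i j ≡ true → π ⟨$⟩ʳ i ≡ j
extend-matching {m} r fun inj = let π , h = go (allFin m) in π , λ i → h (∈-allFin i)
  where
  go : (is : List (Fin m)) → ∃ λ (π : Permutation′ m) → ∀ {i} → i ∈ is → ∀ j → r i j ≡ true → π ⟨$⟩ʳ i ≡ j
  go []       = id , λ ()
  go (i ∷ is) with go is | Fin.any? (λ j → r i j Bool.≟ true)
  ... | π , h | no none      = π , λ { (here refl) j ij → contradiction (j , ij) none ; (there k) → h k }
  ... | π , h | yes (j , ij) = π ∘ₚ transpose (π ⟨$⟩ʳ i) j ,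
    λ { (here refl) j′ ij′ → trans (transpose-here (π ⟨$⟩ʳ i) j) (fun i j j′ ij ij′)
      ; {i′} (there k) j′ ij′ → old i′ k j′ ij′ (i′ ≟ i) }
    where
    old : ∀ i′ → i′ ∈ is → ∀ j′ → r i′ j′ ≡ true → Dec (i′ ≡ i) → transpose (π ⟨$⟩ʳ i) j ⟨$⟩ʳ (π ⟨$⟩ʳ i′) ≡ j′
    old i′ k j′ ij′ (yes refl) = trans (transpose-here (π ⟨$⟩ʳ i) j) (fun i j j′ ij ij′)
    -- The earlier value `j′` is not `π i`, as `π` is injective, and not `j`, as `r` relates `j` to
    -- `i` only. The transposition therefore leaves it in place.
    old i′ k j′ ij′ (no i′≢i)  = trans
      (transpose-other (i′≢i ∘ perm-injective π) (λ e → i′≢i (inj i′ i j (trans (cong (r i′) (trans (sym e) (h k j′ ij′))) ij′) ij)))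
      (h k j′ ij′)

-- Coordinates that trivialise the spanning tree

module Untwisting {G : Graph n} (T : SpanningTree G) (H : Cover G m) where

  private
    E = edgeList G

    extension : (e : Edge n) → ∃ λ (π : Permutation′ m) → ∀ i j → match H (proj₁ e) (proj₂ e) i j ≡ true → π ⟨$⟩ʳ i ≡ j
    extension (u , v) = extend-matching (match H u v) (match-fun H u v)
      (λ i i′ j p p′ → match-fun H v u j i i′ (trans (match-sym H v u j i) p) (trans (match-sym H v u j i′) p′))

  σ₀ : Transport n m
  σ₀ e = proj₁ (extension e)

  tree? : (e : Edge n) → Dec (tadj T (proj₁ e) (proj₂ e) ≡ true)
  tree? (u , v) = tadj T u v Bool.≟ true

  treeEdges : List (Edge n)
  treeEdges = filter tree? E

  tadj-sym : ∀ {a b} → tadj T a b ≡ true → tadj T b a ≡ true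
  tadj-sym {a} {b} = trans (tsymm T b a)

  treeEdges-ordered : ∀ {e} → e ∈ treeEdges → Ordered e
  treeEdges-ordered i = proj₁ (edgeList-sound G (proj₁ (∈-filter⁻ tree? {xs = E} i)))

  joined⇒tadj : ∀ {a b} → Joined treeEdges a b → tadj T a b ≡ true
  joined⇒tadj {a} {b} i = norm-elim (λ a b → tadj T a b ≡ true) tadj-sym a b (proj₂ (∈-filter⁻ tree? {xs = E} i))

  Φ : Forest σ₀ treeEdges
  Φ = forest σ₀ treeEdges (All.tabulate treeEdges-ordered)
  open Forest Φ

  -- A tree edge left out of `F` would close the path of `F` between its ends to a cycle in `T`.
  treeEdges⊆F : ∀ {e} → e ∈ treeEdges → e ∈ F
  treeEdges⊆F {e@(u , v)} i = decide (e ∈ᵉ? F)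
    where
    u<v = treeEdges-ordered i
    decide : Dec (e ∈ F) → e ∈ F
    decide (yes k) = k
    decide (no ∉F) = let xs , c , un = path u v (label-A i) in
      contradiction (proj₁ (chain⇒cycle (chain-map (joined⇒tadj ∘ F⊆A) c) un (long-path Φ c u<v ∉F)
        (joined⇒tadj (Joined-sym treeEdges (subst (_∈ treeEdges) (sym (norm-ordered u<v)) i))))) (acyclic T)

  σ : Transport n m
  σ e = π (proj₁ e) ∘ₚ σ₀ e ∘ₚ flip (π (proj₂ e))

  fixed-tree : ∀ {u v} → tadj T u v ≡ true → ∀ x → Fixed σ (norm u v) x
  fixed-tree {u} {v} t x = trans (cong (π _ ⟨$⟩ˡ_) (gauge (treeEdges⊆F uv∈) x)) (inverseˡ (π _))
    where
    uv∈ : norm u v ∈ treeEdges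
    uv∈ = ∈-filter⁺ tree? (norm∈edgeList G (sub T u v t)) (norm-intro (λ a b → tadj T a b ≡ true) tadj-sym u v t)

  matched⇒transport : ∀ u v x y → match H u v (π u ⟨$⟩ʳ x) (π v ⟨$⟩ʳ y) ≡ true → σ (u , v) ⟨$⟩ʳ x ≡ y
  matched⇒transport u v x y p = trans (cong (π v ⟨$⟩ˡ_) (proj₂ (extension (u , v)) _ _ p)) (inverseˡ (π v))

  -- Counted in the coordinates given by π, in which the tree edges are untwisted.
  private
    independents : ℕ
    independents = ∑ (vecs (allFin m) n) (λ f → 𝟙 (all? (unmatched? H (act π f)) E))

  independents≤PDP : independents ≤ PDP H
  independents≤PDP = ℕ.≤-trans (ℕ.≤-reflexive (∑-act π _)) (independent≤PDP H)

  unmatched-intro : ∀ f {e} → (match H (proj₁ e) (proj₂ e) (π (proj₁ e) ⟨$⟩ʳ lookup f (proj₁ e)) (π (proj₂ e) ⟨$⟩ʳ lookup f (proj₂ e)) ≢ true) →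
                    Unmatched H (act π f) e
  unmatched-intro f {u , v} ne
    rewrite lookup∘tabulate (λ w → π w ⟨$⟩ʳ lookup f w) u | lookup∘tabulate (λ w → π w ⟨$⟩ʳ lookup f w) v = ¬-not ne

  -- Every matched pair of `H` is a pair of `σ`, so extending the matchings to permutations can only
  -- destroy colourings.
  colourings≤PDP : colourings G σ ≤ PDP H
  colourings≤PDP = ℕ.≤-trans
    (∑-mono (vecs (allFin m) n) (λ {f} _ → 𝟙-mono (all? (λ e → ¬? (agree? σ f e)) E) (all? (unmatched? H (act π f)) E)
      (All.map (λ {e} ¬a → unmatched-intro f (λ p → ¬a (matched⇒transport (proj₁ e) (proj₂ e) _ _ p))))))
    independents≤PDP

  module Trivial (trivial : ∀ {e} → e ∈ E → ∀ x → Fixed σ e x) where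

    matched⇒≡ : ∀ {u v} → (u , v) ∈ E → ∀ x y → match H u v (π u ⟨$⟩ʳ x) (π v ⟨$⟩ʳ y) ≡ true → x ≡ y
    matched⇒≡ {u} {v} i x y p = trans (sym (trivial i x)) (matched⇒transport u v x y p)

    Full : Edge n → Set
    Full (u , v) = ∀ x → match H u v (π u ⟨$⟩ʳ x) (π v ⟨$⟩ʳ x) ≡ true

    full? : (e : Edge n) → Dec (Full e)
    full? (u , v) = Fin.all? (λ x → match H u v (π u ⟨$⟩ʳ x) (π v ⟨$⟩ʳ x) Bool.≟ true)

    -- The gauge is the isomorphism: in its coordinates matched pairs have equal entries, and
    -- fullness provides all of these pairs.
    isomorphic : All Full E → CoverGraphIso H (canonicalCover G m)
    isomorphic full = mk↔ₛ′ to from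
        (λ { (w , i) → cong (w ,_) (inverseˡ (π w)) }) (λ { (w , i) → cong (w ,_) (inverseʳ (π w)) }) ,
      λ { (u , i) (v , j) → cong₂ _∨_ (same u v i j) (matching u v i j) }
      where
      to from : Fin n × Fin m → Fin n × Fin m
      to (w , i)   = w , π w ⟨$⟩ˡ i
      from (w , i) = w , π w ⟨$⟩ʳ i
      same : ∀ u v i j → (u ==ᶠ v) ∧ not (i ==ᶠ j) ≡ (u ==ᶠ v) ∧ not ((π u ⟨$⟩ˡ i) ==ᶠ (π v ⟨$⟩ˡ j))
      same u v i j with u ≟ v
      ... | no _     = refl
      ... | yes refl = cong not (true-⇔ {i ==ᶠ j} (≡⇒==ᶠ ∘ cong (π u ⟨$⟩ˡ_) ∘ ==ᶠ⇒≡) (≡⇒==ᶠ ∘ perm-injective (flip (π u)) ∘ ==ᶠ⇒≡))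
      ordered : ∀ {u v} → u Fin.< v → adj G u v ≡ true → ∀ i j → match H u v i j ≡ ((π u ⟨$⟩ˡ i) ==ᶠ (π v ⟨$⟩ˡ j))
      ordered {u} {v} u<v uv i j = true-⇔
        (λ p → ≡⇒==ᶠ (matched⇒≡ uv∈E _ _ (subst₂ (λ i j → match H u v i j ≡ true) (sym (inverseʳ (π u))) (sym (inverseʳ (π v))) p)))
        (λ p → subst₂ (λ i j → match H u v i j ≡ true) (inverseʳ (π u))
          (trans (cong (π v ⟨$⟩ʳ_) (==ᶠ⇒≡ p)) (inverseʳ (π v))) (All.lookup full uv∈E (π u ⟨$⟩ˡ i)))
        where uv∈E = edgeList-complete G u<v uv
      matching : ∀ u v i j → match H u v i j ≡ adj G u v ∧ ((π u ⟨$⟩ˡ i) ==ᶠ (π v ⟨$⟩ˡ j))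
      matching u v i j with adj G u v in uv
      ... | false = ¬-not (λ p → contradiction (trans (sym uv) (match-adj H u v i j p)) (λ ()))
      ... | true with Fin.<-cmp u v
      ...   | tri< u<v _ _  = ordered u<v uv i j
      ...   | tri≈ _ refl _ = contradiction refl (adj-distinct G uv)
      ...   | tri> _ _ v<u  = trans (match-sym H u v i j) (trans (ordered v<u (adj-sym G uv) j i)
        (true-⇔ {(π v ⟨$⟩ˡ j) ==ᶠ (π u ⟨$⟩ˡ i)} (≡⇒==ᶠ ∘ sym ∘ ==ᶠ⇒≡) (≡⇒==ᶠ ∘ sym ∘ ==ᶠ⇒≡)))

    -- A colouring whose only monochromatic pair is u, v is not proper but avoids the unmatched pair at x.
    strict : n ≤ m → ∀ {u v} → (u , v) ∈ E → ∀ x → match H u v (π u ⟨$⟩ʳ x) (π v ⟨$⟩ʳ x) ≢ true →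
             colourings {m = m} G ι < independents
    strict n≤m {u} {v} uv∈E x missing = ∑-strict (vecs (allFin m) n) pointwise (∈-vecs f (λ i → ∈-allFin _))
      (subst₂ _<_ (sym (𝟙-no (all? (λ e → ¬? (agree? ι f e)) E) (λ k → All.lookup k uv∈E (trans at-u (sym at-v)))))
                  (sym (𝟙-yes (all? (unmatched? H (act π f)) E) (All.tabulate λ { {a , b} i → unmatched-intro f (avoid a b i) })))
                  (s≤s z≤n))
      where
      u<v = proj₁ (edgeList-sound G uv∈E)
      pointwise : ∀ f → 𝟙 (all? (λ e → ¬? (agree? ι f e)) E) ≤ 𝟙 (all? (unmatched? H (act π f)) E)
      pointwise f = 𝟙-mono (all? (λ e → ¬? (agree? ι f e)) E) (all? (unmatched? H (act π f)) E)
        (λ k → All.tabulate (λ { {a , b} i → unmatched-intro f (All.lookup k i ∘ matched⇒≡ i _ _) }))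
      -- As `n ≤ m`, the vertices can receive distinct colours. The transposition gives the colour
      -- `x` to `u`, and `value` then repeats it at `v`.
      τ = transpose (inject≤ u n≤m) x
      spread : Fin n → Fin m
      spread w = τ ⟨$⟩ʳ inject≤ w n≤m
      spread-injective : ∀ {a b} → spread a ≡ spread b → a ≡ b
      spread-injective e = Fin.inject≤-injective n≤m n≤m _ _ (perm-injective τ e)
      spread-u : spread u ≡ x
      spread-u = transpose-here (inject≤ u n≤m) x
      value : Fin n → Fin m
      value w with w ≟ v
      ... | yes _ = x
      ... | no _  = spread w
      f : Vec (Fin m) n
      f = tabulate value
      value-v : value v ≡ x
      value-v with v ≟ v
      ... | yes _ = refl
      ... | no ¬p = contradiction refl ¬p
      value-u : value u ≡ x
      value-u with u ≟ v
      ... | yes _ = refl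
      ... | no _  = spread-u
      at-u : lookup f u ≡ x
      at-u = trans (lookup∘tabulate value u) value-u
      at-v : lookup f v ≡ x
      at-v = trans (lookup∘tabulate value v) value-v
      collision : ∀ a b → a Fin.< b → value a ≡ value b → a ≡ u × b ≡ v
      collision a b a<b e with a ≟ v | b ≟ v
      ... | yes refl | yes refl = contradiction a<b (Fin.<-irrefl refl)
      ... | no _     | no _     = contradiction a<b (Fin.<-irrefl (spread-injective e))
      ... | no _     | yes refl = spread-injective (trans e (sym spread-u)) , refl
      ... | yes refl | no _     = contradiction (subst (v Fin.<_) (spread-injective (trans (sym e) (sym spread-u))) a<b) (Fin.<-asym u<v)
      avoid : ∀ a b → (a , b) ∈ E → match H a b (π a ⟨$⟩ʳ lookup f a) (π b ⟨$⟩ʳ lookup f b) ≢ true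
      avoid a b i p with collision a b (proj₁ (edgeList-sound G i))
        (trans (sym (lookup∘tabulate value a)) (trans (matched⇒≡ i _ _ p) (lookup∘tabulate value b)))
      ... | refl , refl = missing (subst₂ (λ s t → match H u v (π u ⟨$⟩ʳ s) (π v ⟨$⟩ʳ t) ≡ true) at-u at-v p)

    trivial-case : n ≤ m → ¬ CoverGraphIso H (canonicalCover G m) → P G m < PDP H
    trivial-case n≤m ¬iso with all? full? E
    ... | yes full = contradiction (isomorphic full) ¬iso
    ... | no ¬full with (u , v) , i , ¬f ← find (¬All⇒Any¬ full? E ¬full)
                   with x , missing ← Fin.¬∀⟶∃¬ m _ (λ x → match H u v (π u ⟨$⟩ʳ x) (π v ⟨$⟩ʳ x) Bool.≟ true) ¬f =
      ℕ.≤-<-trans (P≤colourings G m) (ℕ.<-≤-trans (strict n≤m i x missing) independents≤PDP)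

theorem1p3 : (n : ℕ) (G : Graph n) → DPGood G → DPStar G
-- The first summand makes `m` exceed `threshold` for twisted covers; the second provides `n`
-- distinct colours for the untwisted ones.
theorem1p3 n G W = suc threshold + n , proof
  where
  open Good G W using (threshold; module Twisted)
  open DPGoodWitness W using (T; e; e-surj)
  proof : ∀ m → suc threshold + n ≤ m → (H : Cover G m) → ¬ CoverGraphIso H (canonicalCover G m) → P G m < PDP H
  proof m M≤m H ¬iso = decide (any? (λ g → Fin.any? (moved? σ g)) (edgeList G))
    where
    open Untwisting T H
    large : threshold < m
    large = ℕ.≤-trans (ℕ.m≤m+n (suc threshold) n) M≤m
    instance
      m≢0 : NonZero m
      m≢0 = >-nonZero (ℕ.≤-trans (s≤s z≤n) large)
    decide : Dec (Any (λ g → ∃ (Moved σ g)) (edgeList G)) → P G m < PDP H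
    decide (no none) = Trivial.trivial-case
      (λ {g} i x → decidable-stable (fixed? σ g x) (λ ¬f → none (lose i (x , ¬f))))
      (ℕ.≤-trans (ℕ.m≤n+m n (suc threshold)) M≤m) ¬iso
    decide (yes some) with (u , v) , i , x , moved ← find some
                      with u<v , uv ← edgeList-sound G i
                      with tadj T u v in t
    ... | true  = contradiction (subst (λ g → Fixed σ g x) (norm-ordered u<v) (fixed-tree t x)) moved
    ... | false with j , refl ← e-surj u v u<v uv t =
      ℕ.≤-<-trans (P≤colourings G m) (ℕ.<-≤-trans
        (Twisted.twisted m σ fixed-tree large j twist>0) colourings≤PDP)
      where
      twist>0 : 0 < twist σ (e j)
      twist>0 = ℕ.≤-trans (ℕ.≤-reflexive (sym (𝟙-yes (moved? σ (e j) x) moved)))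
        (∑-member (λ x → 𝟙 (moved? σ (e j) x)) (∈-allFin x))
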